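{- For any $X\in{}^{\omega}2$ there exists a partial function $\mathrm{Sel}^X$ from $\omega\times{}^{<\omega}\omega$ to $\omega$, partial feedback computable in $X$, such that for all $e\in\omega$ and $\vec m\in{}^{<\omega}\omega$ the following are equivalent: (i) $\exists p\in\omega\;\;\langle e\rangle^X(p,\vec m)\downarrow$; (ii) $\langle e\rangle^X(\mathrm{Sel}^X(e,\vec m),\vec m)\downarrow$ (in particular $\mathrm{Sel}^X(e,\vec m)$ is defined). Moreover the function $\mathrm{Sel}^X$ is uniformly definable in $X$: there is a single index $s\in\omega$ such that for every $X\in{}^\omega 2$ one may take $\mathrm{Sel}^X(e,\vec m)\simeq\langle s\rangle^X(e,\vec m)$.
   Context: **Feedback computation.** Programs are ordinary oracle Turing machine programs (with oracle $X$), indexed by $e\in\omega$ in a standard way, with an additional instruction allowing the machine at any stage to issue a query $Q^X(e',m')$, with $e',m'$ integers computed by the machine, asking whether the feedback computation $\langle e'\rangle^X(m')$ converges or diverges, and receiving (in one step) an answer in $\{\downarrow,\uparrow\}$. Finite sequences of integers are coded by integers, so an input $m$ may be a tuple. Formally, for a partial function $C$ let $I(C)$ be the set of pairs $\langle\langle e,m,X\rangle,\langle j,k\rangle\rangle$ such that program $e$, run on input $m$ with oracle $X$, makes only queries $Q^X(e',m')$ for which $C(\langle e',m',X\rangle)=\langle j',k'\rangle$ is defined, each such query being answered by $j'$, and either this run halts with output $k\in\omega$ and $j=\,\downarrow$, or it runs forever and $j=\,\uparrow$, $k=\omega$. Let $I_\infty$ be the least fixed point of the monotone operator $I$, obtained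 by iteration from $\emptyset$. Write $\langle e\rangle^X(m)\downarrow k$ iff $I_\infty(\langle e,m,X\rangle)=\langle\downarrow,k\rangle$, and $\langle e\rangle^X(m)\downarrow$ iff this holds for some $k\in\omega$. (The remaining possibilities, value $\langle\uparrow,\omega\rangle$ or $\langle e,m,X\rangle\notin\mathrm{dom}(I_\infty)$, are "divergent" and "freezing" respectively; neither is $\downarrow$.) A partial function $f$ on integers (or tuples) is partial feedback computable in $X$ if for some $e$, $f(m)\simeq\langle e\rangle^X(m)$ for all $m$ (defined exactly when $\langle e\rangle^X(m)\downarrow$, with that value). -}

module Defs where

open import Data.Bool.Base using (Bool; if_then_else_)
open import Data.List.Base using (List; []; _∷_; map; head; drop; replicate)
open import Data.Maybe.Base using (fromMaybe)
open import Data.Nat.Base using (ℕ; zero; suc; _+_; _≤_; z≤n; s≤s)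
open import Data.Nat.Properties
  using (_≟_; +-comm; +-suc; +-identityʳ; ≤-refl; ≤-trans; m≤m+n; m≤n+m)
open import Data.Product.Base using (_×_; _,_; proj₁; proj₂; Σ-syntax; ∃-syntax)
open import Function.Bundles using (_⇔_)
open import Relation.Binary.Construct.Closure.ReflexiveTransitive using (Star)
open import Relation.Binary.PropositionalEquality
  using (_≡_; refl; sym; trans; cong; cong₂; module ≡-Reasoning)
open import Relation.Nullary.Decidable.Core using (does)

------------------------------------------------------------------------
-- Coding of pairs and finite sequences

triangle : ℕ → ℕ
triangle zero    = zero
triangle (suc n) = suc n + triangle n

-- Cantor pairing, a bijection ℕ × ℕ → ℕ with inverse unpair.
pair : ℕ → ℕ → ℕ
pair x y = triangle (x + y) + x

-- The successor of a pair in Cantor's diagonal enumeration.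
nextPair : ℕ × ℕ → ℕ × ℕ
nextPair (x , zero)  = zero , suc x
nextPair (x , suc y) = suc x , y

unpair : ℕ → ℕ × ℕ
unpair zero    = zero , zero
unpair (suc n) = nextPair (unpair n)

code : List ℕ → ℕ
code []       = zero
code (x ∷ xs) = suc (pair x (code xs))

-- The first argument only bounds the recursion.  Each step at least
-- decrements the second, so starting with the two equal loses nothing
-- (see decode-code).
decodeWithin : ℕ → ℕ → List ℕ
decodeWithin zero    _       = []
decodeWithin (suc b) zero    = []
decodeWithin (suc b) (suc n) =
  proj₁ (unpair n) ∷ decodeWithin b (proj₂ (unpair n))

decode : ℕ → List ℕ
decode n = decodeWithin n n

------------------------------------------------------------------------
-- Programs: oracle Turing machines with several two-way infinite tapes
-- over the alphabet {blank, stroke}, written as lists of instructions.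
-- The control state of the machine is the position of an instruction.

data Symbol : Set where
  blank stroke : Symbol

data Direction : Set where
  left right stay : Direction

record Action : Set where
  constructor action
  field
    write : Symbol
    move  : Direction
    goto  : ℕ

-- Tapes are named by natural numbers; a program mentions only finitely
-- many of them.
data Instruction : Set where
  halt   : Instruction
  -- On the given tape, perform the first action if the scanned symbol
  -- is blank and the second if it is a stroke.
  act    : (tape : ℕ) (onBlank onStroke : Action) → Instruction
  -- Ask for the value X(n), with n the number on the given tape.
  oracle : (tape : ℕ) (if0 if1 : ℕ) → Instruction
  -- Ask the feedback query Q^X(e′, m′), with e′ and m′ the numbers on
  -- the two given tapes.
  query  : (tapeₑ tapeₘ : ℕ) (if↓ if↑ : ℕ) → Instruction

Program : Set
Program = List Instruction

-- Leaving the program also halts the machine.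
fetch : Program → ℕ → Instruction
fetch P q = fromMaybe halt (head (drop q P))

------------------------------------------------------------------------
-- Indexing of programs: every number is the index of a program, and
-- every program has an index (see program-index).

toSymbol : ℕ → Symbol
toSymbol zero    = blank
toSymbol (suc _) = stroke

toDirection : ℕ → Direction
toDirection 0             = left
toDirection 1             = right
toDirection (suc (suc _)) = stay

toAction : ℕ → Action
toAction n =
  let w , r = unpair n
      d , q = unpair r
  in action (toSymbol w) (toDirection d) q

withTag : ℕ → ℕ → Instruction
withTag 0 _ = halt
withTag 1 r =
  let t , as = unpair r
      a , b  = unpair as
  in act t (toAction a) (toAction b)
withTag 2 r =
  let t , qs = unpair r
      q , q′ = unpair qs
  in oracle t q q′
withTag (suc (suc (suc _))) r =
  let ts , qs = unpair r
      t , t′  = unpair ts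
      q , q′  = unpair qs
  in query t t′ q q′

toInstruction : ℕ → Instruction
toInstruction n = withTag (proj₁ (unpair n)) (proj₂ (unpair n))

program : ℕ → Program
program e = map toInstruction (decode e)

fromSymbol : Symbol → ℕ
fromSymbol blank  = 0
fromSymbol stroke = 1

fromDirection : Direction → ℕ
fromDirection left  = 0
fromDirection right = 1
fromDirection stay  = 2

fromAction : Action → ℕ
fromAction (action w d q) = pair (fromSymbol w) (pair (fromDirection d) q)

fromInstruction : Instruction → ℕ
fromInstruction halt             = pair 0 0
fromInstruction (act t a b)      = pair 1 (pair t (pair (fromAction a) (fromAction b)))
fromInstruction (oracle t q q′)  = pair 2 (pair t (pair q q′))
fromInstruction (query t t′ q q′) = pair 3 (pair (pair t t′) (pair q q′))

index : Program → ℕ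
index P = code (map fromInstruction P)

------------------------------------------------------------------------
-- Configurations

-- The cells to the left and to the right of the head, nearest first;
-- all cells beyond the two lists are blank.
record Tape : Set where
  constructor tape
  field
    before  : List Symbol
    scanned : Symbol
    after   : List Symbol

shift : Direction → Tape → Tape
shift left  (tape []       s as)       = tape [] blank (s ∷ as)
shift left  (tape (b ∷ bs) s as)       = tape bs b (s ∷ as)
shift right (tape bs       s [])       = tape (s ∷ bs) blank []
shift right (tape bs       s (a ∷ as)) = tape (s ∷ bs) a as
shift stay  τ                          = τ

startingWith : List Symbol → Tape
startingWith []       = tape [] blank []
startingWith (s ∷ ss) = tape [] s ss

-- Numbers are written in unary: the number on a tape is the number of
-- consecutive strokes from the scanned cell to the right.
strokes : List Symbol → ℕ
strokes []            = zero
strokes (blank ∷ _)   = zero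
strokes (stroke ∷ ss) = suc (strokes ss)

value : Tape → ℕ
value (tape _ s as) = strokes (s ∷ as)

record Config : Set where
  constructor config
  field
    state : ℕ
    tapes : ℕ → Tape

open Config

_[_]≔_ : (ℕ → Tape) → ℕ → Tape → (ℕ → Tape)
(τs [ t ]≔ τ) u = if does (u ≟ t) then τ else τs u

perform : ℕ → Action → (ℕ → Tape) → Config
perform t (action w d q) τs =
  config q (τs [ t ]≔ shift d (record (τs t) { scanned = w }))

-- Input and output are on tape 0.
input : ℕ → ℕ → Tape
input m zero    = startingWith (replicate m stroke)
input m (suc _) = startingWith []

initial : ℕ → Config
initial m = config 0 (input m)

output : Config → ℕ
output c = value (tapes c 0)

------------------------------------------------------------------------
-- Runs

Oracle : Set
Oracle = ℕ → Bool

data Next : Set where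
  stop : Next
  go   : Config → Next
  ask  : (e′ m′ : ℕ) (if↓ if↑ : Config) → Next

choose : Symbol → Action → Action → Action
choose blank  a b = a
choose stroke a b = b

execute : Oracle → Instruction → (ℕ → Tape) → Next
execute X halt               τs = stop
execute X (act t a b)        τs = go (perform t (choose (Tape.scanned (τs t)) a b) τs)
execute X (oracle t q₀ q₁)   τs = go (config (if X (value (τs t)) then q₁ else q₀) τs)
execute X (query t t′ q↓ q↑) τs =
  ask (value (τs t)) (value (τs t′)) (config q↓ τs) (config q↑ τs)

next : Program → Oracle → Config → Next
next P X (config q τs) = execute X (fetch P q) τs

-- ↓ k stands for ⟨↓, k⟩, and ↑ for ⟨↑, ω⟩.
data Outcome : Set where
  ↓ : ℕ → Outcome
  ↑ : Outcome

-- The partial functions C on triples ⟨e, m, X⟩ are represented by their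
-- graphs.  Feedback queries do not change X, so C is given separately
-- for each X.
Graph : Set₁
Graph = (e m : ℕ) → Outcome → Set

-- There is no step at a query on which C is undefined.
data Step (C : Graph) (P : Program) (X : Oracle) (c : Config) : Config → Set where
  plain     : ∀ {c′} → next P X c ≡ go c′ → Step C P X c c′
  answered↓ : ∀ {e′ m′ c↓ c↑ k} → next P X c ≡ ask e′ m′ c↓ c↑ →
              C e′ m′ (↓ k) → Step C P X c c↓
  answered↑ : ∀ {e′ m′ c↓ c↑} → next P X c ≡ ask e′ m′ c↓ c↑ →
              C e′ m′ ↑ → Step C P X c c↑

I : Oracle → Graph → Graph
I X C e m (↓ k) =
  ∃[ c ] Star (Step C (program e) X) (initial m) c
       × next (program e) X c ≡ stop
       × output c ≡ k
I X C e m ↑ =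
  Σ[ run ∈ (ℕ → Config) ]
    run 0 ≡ initial m × (∀ n → Step C (program e) X (run n) (run (suc n)))

-- The least fixed point of I X.
data I∞ (X : Oracle) (e m : ℕ) (r : Outcome) : Set where
  closed : I X (I∞ X) e m r → I∞ X e m r

⟨_⟩^_[_]↓=_ : ℕ → Oracle → ℕ → ℕ → Set
⟨ e ⟩^ X [ m ]↓= k = I∞ X e m (↓ k)

⟨_⟩^_[_]↓ : ℕ → Oracle → ℕ → Set
⟨ e ⟩^ X [ m ]↓ = ∃[ k ] ⟨ e ⟩^ X [ m ]↓= k

------------------------------------------------------------------------
-- Partial functions and feedback computability

record _⇀_ (A B : Set) : Set₁ where
  field
    graph      : A → B → Set
    functional : ∀ {a b b′} → graph a b → graph a b′ → b ≡ b′

open _⇀_ public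

-- The argument (n , m⃗) is presented to the machine as the sequence n ∷ m⃗.
_Computes_In_ : ℕ → ((ℕ × List ℕ) ⇀ ℕ) → Oracle → Set
s Computes f In X = ∀ n m⃗ k → graph f (n , m⃗) k ⇔ (⟨ s ⟩^ X [ code (n ∷ m⃗) ]↓= k)

PartialFeedbackComputableIn : Oracle → ((ℕ × List ℕ) ⇀ ℕ) → Set
PartialFeedbackComputableIn X f = ∃[ s ] s Computes f In X

-- The right-hand side includes that Sel (e , m⃗) is defined.
Selects : Oracle → ((ℕ × List ℕ) ⇀ ℕ) → Set
Selects X Sel = ∀ e m⃗ →
  (∃[ p ] ⟨ e ⟩^ X [ code (p ∷ m⃗) ]↓) ⇔
  (∃[ q ] graph Sel (e , m⃗) q × ⟨ e ⟩^ X [ code (q ∷ m⃗) ]↓)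

------------------------------------------------------------------------
-- The codings are correct.

private
  unpair-pair′ : ∀ n x y → x + y ≡ n → unpair (pair x y) ≡ (x , y)
  unpair-pair′ zero    zero    zero    _  = refl
  unpair-pair′ (suc n) zero    (suc y) refl = begin
    unpair (triangle (suc y) + 0)     ≡⟨ cong unpair (+-identityʳ (triangle (suc y))) ⟩
    nextPair (unpair (y + triangle y)) ≡⟨ cong (λ i → nextPair (unpair i)) y+t≡pair ⟩
    nextPair (unpair (pair y 0))      ≡⟨ cong nextPair (unpair-pair′ n y 0 (+-identityʳ y)) ⟩
    nextPair (y , 0)                  ∎
    where
    open ≡-Reasoning
    y+t≡pair : y + triangle y ≡ pair y 0
    y+t≡pair = trans (+-comm y (triangle y)) (cong (λ i → triangle i + y) (sym (+-identityʳ y)))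
  unpair-pair′ n (suc x) y eq = begin
    unpair (triangle (suc x + y) + suc x)          ≡⟨ cong unpair (+-suc (triangle (suc x + y)) x) ⟩
    nextPair (unpair (triangle (suc (x + y)) + x)) ≡⟨ cong (λ i → nextPair (unpair (triangle i + x))) (sym (+-suc x y)) ⟩
    nextPair (unpair (pair x (suc y)))             ≡⟨ cong nextPair (unpair-pair′ n x (suc y) (trans (+-suc x y) eq)) ⟩
    nextPair (x , suc y)                           ∎
    where open ≡-Reasoning

unpair-pair : ∀ x y → unpair (pair x y) ≡ (x , y)
unpair-pair x y = unpair-pair′ (x + y) x y refl

pair-unpair : ∀ n → pair (proj₁ (unpair n)) (proj₂ (unpair n)) ≡ n
pair-unpair zero = refl
pair-unpair (suc n) with unpair n | pair-unpair n
... | x , zero  | eq = trans (+-identityʳ _) (cong suc (trans (+-comm x (triangle x))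
                         (trans (cong (λ i → triangle i + x) (sym (+-identityʳ x))) eq)))
... | x , suc y | eq = trans (+-suc (triangle (suc x + y)) x)
                         (cong suc (trans (cong (λ i → triangle i + x) (sym (+-suc x y))) eq))

private
  n≤triangle : ∀ n → n ≤ triangle n
  n≤triangle zero    = z≤n
  n≤triangle (suc n) = m≤m+n (suc n) (triangle n)

  y≤pair : ∀ x y → y ≤ pair x y
  y≤pair x y = ≤-trans (m≤n+m y x) (≤-trans (n≤triangle (x + y)) (m≤m+n _ x))

  decodeWithin-code : ∀ b xs → code xs ≤ b → decodeWithin b (code xs) ≡ xs
  decodeWithin-code zero    []       _ = refl
  decodeWithin-code (suc b) []       _ = refl
  decodeWithin-code (suc b) (x ∷ xs) (s≤s le)
    rewrite unpair-pair x (code xs) =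
    cong (x ∷_) (decodeWithin-code b xs (≤-trans (y≤pair x (code xs)) le))

decode-code : ∀ xs → decode (code xs) ≡ xs
decode-code xs = decodeWithin-code (code xs) xs ≤-refl

private
  toSymbol-from : ∀ s → toSymbol (fromSymbol s) ≡ s
  toSymbol-from blank  = refl
  toSymbol-from stroke = refl

  toDirection-from : ∀ d → toDirection (fromDirection d) ≡ d
  toDirection-from left  = refl
  toDirection-from right = refl
  toDirection-from stay  = refl

  toAction-from : ∀ a → toAction (fromAction a) ≡ a
  toAction-from (action w d q)
    rewrite unpair-pair (fromSymbol w) (pair (fromDirection d) q)
          | unpair-pair (fromDirection d) q
          | toSymbol-from w | toDirection-from d = refl

  toInstruction-from : ∀ i → toInstruction (fromInstruction i) ≡ i
  toInstruction-from halt = refl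
  toInstruction-from (act t a b)
    rewrite unpair-pair 1 (pair t (pair (fromAction a) (fromAction b)))
          | unpair-pair t (pair (fromAction a) (fromAction b))
          | unpair-pair (fromAction a) (fromAction b)
          | toAction-from a | toAction-from b = refl
  toInstruction-from (oracle t q q′)
    rewrite unpair-pair 2 (pair t (pair q q′))
          | unpair-pair t (pair q q′)
          | unpair-pair q q′ = refl
  toInstruction-from (query t t′ q q′)
    rewrite unpair-pair 3 (pair (pair t t′) (pair q q′))
          | unpair-pair (pair t t′) (pair q q′)
          | unpair-pair t t′
          | unpair-pair q q′ = refl

  map-toInstruction : ∀ P → map toInstruction (map fromInstruction P) ≡ P
  map-toInstruction []      = refl
  map-toInstruction (i ∷ P) = cong₂ _∷_ (toInstruction-from i) (map-toInstruction P)

program-index : ∀ P → program (index P) ≡ P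
program-index P =
  trans (cong (map toInstruction) (decode-code (map fromInstruction P))) (map-toInstruction P)

{-# OPTIONS --safe #-}
module Submission where

open import Defs
open import Axiom.ExcludedMiddle using (ExcludedMiddle)
open import Data.Bool.Base using (Bool; true; false; if_then_else_)
open import Data.Empty using (⊥-elim)
open import Data.Fin.Base using (Fin; zero; suc; toℕ)
open import Data.Fin.Properties using (toℕ-injective) renaming (_≟_ to _≟ᶠ_)
open import Data.List.Base using (List; []; _∷_; _++_; drop; length; map; replicate)
open import Data.List.Properties using (length-++)
open import Data.Nat.Base using (ℕ; zero; suc; pred; _+_; _≤_; z≤n; s≤s)
open import Data.Nat.Properties
  using (_≟_; +-assoc; +-comm; +-identityʳ; +-suc; m≤m+n; m≤n+m; ≤-refl; ≤-trans)
open import Data.Product.Base using (_×_; _,_; proj₁; proj₂; map₂; Σ-syntax; ∃-syntax)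
open import Data.Sum.Base using (_⊎_; inj₁; inj₂)
open import Data.Unit.Base using (⊤; tt)
open import Data.Vec.Base using (Vec; []; _∷_; lookup; updateAt)
open import Data.Vec.Properties using (lookup∘updateAt; lookup∘updateAt′)
open import Function.Bundles using (mk⇔)
open import Level using (0ℓ)
open import Relation.Binary.Construct.Closure.ReflexiveTransitive
  using (Star; ε; _◅_; _◅◅_; gmap)
open import Relation.Binary.PropositionalEquality
  using (_≡_; _≢_; refl; sym; trans; cong; cong₂; subst)
open import Relation.Nullary using (¬_; yes; no)
open import Relation.Nullary.Decidable using (does; dec-true; dec-false)

-- As in Gandy's selection theorem, everything rests on comparing computations.
-- Let compare a b simulate b and, before each query b′ of b, ask for
-- compare b′ a: it halts if the answer is ↑, asks b′ itself if it is ↓, and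
-- diverges if the run of b ends.  If compare a b diverges, then all queries of b
-- were answered, so b is defined; if it converges, then some compare b′ a
-- diverges, so a is defined.  By induction on b, compare a b and compare b a are
-- defined, that is, do not freeze, whenever b is defined.
--
-- Let probe a be defined just when a converges, and let search k ask whether
-- probe (e , k ∷ m⃗) wins its comparison with search (k + 1), returning k if it
-- does and continuing as search (k + 1) otherwise.  If candidate p converges then
-- search p, hence search 0, is defined.  A lost comparison at k has a derivation
-- containing the one for k + 1 as a proper part, so a defined search ends after
-- finitely many losses, at a winner.
--
-- A single program u does all this, its index being part of its input; it
-- iterates a total function computed by a counter program.

-- The candidates cannot be tried in turn or dovetailed: a query to a freezing computation freezes
-- the one that asks. Every question must be certain of an answer although one of its two subjects
-- may freeze.
--
-- Rank a defined computation by the height of its derivation, and give rank ∞ to a freezing one. If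
-- one of a, b is defined, `compare a b` answers ↓ when a has smaller rank than b, and ↑ otherwise:
-- the rank of b is at most that of a just when every query of b has rank below that of a, which is
-- why the roles swap at each query.
--
-- Being defined includes diverging, so ranks alone do not see convergence; `probe` turns
-- convergence into definedness. Infinitely many candidates are reduced to comparisons of two by
-- counting all later ones as the single computation `search (k + 1)`.
--
-- No ordinals are formalised. Facts about one run are proved for an arbitrary graph C of answers;
-- instantiated with an induction hypothesis, they express that one derivation is part of another.
-- Passing the index u along takes the place of the recursion theorem.

-- Transition systems with feedback queries

data Move (S : Set) : Set where
  stop : ℕ → Move S
  go   : S → Move S
  ask  : (e m : ℕ) (s↓ s↑ : S) → Move S

System : Set → Set
System S = S → Move S

data Trans {S : Set} (C : Graph) (σ : System S) (s : S) : S → Set where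
  silent    : ∀ {s′} → σ s ≡ go s′ → Trans C σ s s′
  answered↓ : ∀ {e m s↓ s↑ k} → σ s ≡ ask e m s↓ s↑ → C e m (↓ k) → Trans C σ s s↓
  answered↑ : ∀ {e m s↓ s↑} → σ s ≡ ask e m s↓ s↑ → C e m ↑ → Trans C σ s s↑

Behaviour : {S : Set} → Graph → System S → S → Outcome → Set
Behaviour C σ s (↓ k) = ∃[ s′ ] Star (Trans C σ) s s′ × σ s′ ≡ stop k
Behaviour {S} C σ s ↑ =
  Σ[ run ∈ (ℕ → S) ] run 0 ≡ s × (∀ n → Trans C σ (run n) (run (suc n)))

Silent : {S : Set} → System S → S → S → Set
Silent σ = Star (λ s s′ → σ s ≡ go s′)

module _ {S : Set} {C : Graph} {σ : System S} where

  trans-stop : ∀ {s s′ k} → σ s ≡ stop k → ¬ Trans C σ s s′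
  trans-stop eq (silent eq′) with () ← trans (sym eq) eq′
  trans-stop eq (answered↓ eq′ _) with () ← trans (sym eq) eq′
  trans-stop eq (answered↑ eq′ _) with () ← trans (sym eq) eq′

  trans-go : ∀ {s s₁ s′} → σ s ≡ go s₁ → Trans C σ s s′ → s′ ≡ s₁
  trans-go eq (silent eq′) with refl ← trans (sym eq) eq′ = refl
  trans-go eq (answered↓ eq′ _) with () ← trans (sym eq) eq′
  trans-go eq (answered↑ eq′ _) with () ← trans (sym eq) eq′

  trans-ask : ∀ {s e m s↓ s↑ s′} → σ s ≡ ask e m s↓ s↑ → Trans C σ s s′ →
              (∃[ k ] C e m (↓ k) × s′ ≡ s↓) ⊎ (C e m ↑ × s′ ≡ s↑)
  trans-ask eq (silent eq′) with () ← trans (sym eq) eq′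
  trans-ask eq (answered↓ eq′ c) with refl ← trans (sym eq) eq′ = inj₁ (_ , c , refl)
  trans-ask eq (answered↑ eq′ c) with refl ← trans (sym eq) eq′ = inj₂ (c , refl)

  silent⇒trans : ∀ {s s′} → Silent σ s s′ → Star (Trans C σ) s s′
  silent⇒trans = gmap (λ s → s) silent

  cons-behaviour : ∀ {s s′ r} → Trans C σ s s′ → Behaviour C σ s′ r → Behaviour C σ s r
  cons-behaviour {r = ↓ k} t (s″ , p , eq) = s″ , t ◅ p , eq
  cons-behaviour {s = s} {r = ↑} t (run , refl , steps) =
    (λ { zero → s ; (suc n) → run n }) , refl , (λ { zero → t ; (suc n) → steps n })

  uncons-behaviour : ∀ {s r} → Behaviour C σ s r →
    (∃[ k ] r ≡ ↓ k × σ s ≡ stop k) ⊎ (∃[ s′ ] Trans C σ s s′ × Behaviour C σ s′ r)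
  uncons-behaviour {r = ↓ k} (s′ , ε , eq)     = inj₁ (k , refl , eq)
  uncons-behaviour {r = ↓ k} (s′ , t ◅ p , eq) = inj₂ (_ , t , s′ , p , eq)
  uncons-behaviour {r = ↑} (run , refl , steps) =
    inj₂ (run 1 , steps 0 , (λ n → run (suc n)) , refl , λ n → steps (suc n))

  behaviour-stop : ∀ {s k r} → σ s ≡ stop k → Behaviour C σ s r → r ≡ ↓ k
  behaviour-stop eq b with uncons-behaviour b
  ... | inj₁ (k , refl , eq′) with refl ← trans (sym eq) eq′ = refl
  ... | inj₂ (_ , t , _) = ⊥-elim (trans-stop eq t)

  behaviour-go : ∀ {s s′ r} → σ s ≡ go s′ → Behaviour C σ s r → Behaviour C σ s′ r
  behaviour-go eq b with uncons-behaviour b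
  ... | inj₁ (k , refl , eq′) with () ← trans (sym eq) eq′
  ... | inj₂ (_ , t , b′) with refl ← trans-go eq t = b′

  behaviour-ask : ∀ {s e m s↓ s↑ r} → σ s ≡ ask e m s↓ s↑ → Behaviour C σ s r →
    (∃[ k ] C e m (↓ k) × Behaviour C σ s↓ r) ⊎ (C e m ↑ × Behaviour C σ s↑ r)
  behaviour-ask eq b with uncons-behaviour b
  ... | inj₁ (k , refl , eq′) with () ← trans (sym eq) eq′
  ... | inj₂ (_ , t , b′) with trans-ask eq t
  ... | inj₁ (k , c , refl) = inj₁ (k , c , b′)
  ... | inj₂ (c , refl) = inj₂ (c , b′)

  unfold-run : {Inv : S → Set} →
    (∀ {s} → Inv s → ∃[ s′ ] Trans C σ s s′ × Inv s′) →
    ∀ {s} → Inv s → Behaviour C σ s ↑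
  unfold-run {Inv} next {s} inv = (λ n → proj₁ (states n)) , refl , λ n → proj₁ (proj₂ (next (proj₂ (states n))))
    where
    states : ℕ → Σ[ s ∈ S ] Inv s
    states zero    = s , inv
    states (suc n) with states n
    ... | _ , i = proj₁ (next i) , proj₂ (proj₂ (next i))

  -- Excluded middle decides whether a halt can be reached. If not, this is added to the invariant,
  -- and progress can then only be made by a transition, for ever.
  progress⇒behaviour : ExcludedMiddle 0ℓ → {Inv : S → Set} →
    (∀ {s} → Inv s → (∃[ k ] σ s ≡ stop k) ⊎ (∃[ s′ ] Trans C σ s s′ × Inv s′)) →
    ∀ {s} → Inv s → ∃[ r ] Behaviour C σ s r
  progress⇒behaviour em {Inv} progress {s} inv with em {∃[ k ] Behaviour C σ s (↓ k)}
  ... | yes (k , b) = ↓ k , b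
  ... | no ¬halts = ↑ , unfold-run advance (inv , ¬halts)
    where
    advance : ∀ {s} → Inv s × ¬ (∃[ k ] Behaviour C σ s (↓ k)) →
              ∃[ s′ ] Trans C σ s s′ × (Inv s′ × ¬ (∃[ k ] Behaviour C σ s′ (↓ k)))
    advance (i , ¬h) with progress i
    ... | inj₁ (k , eq)     = ⊥-elim (¬h (k , _ , ε , eq))
    ... | inj₂ (s′ , t , i′) = s′ , t , i′ , λ (k , b) → ¬h (k , cons-behaviour {r = ↓ k} t b)

-- Weak bisimulation: every move of τ is a move of σ up to silent transitions.
module Implementation {S A : Set} (σ : System S) (τ : System A) (R : S → A → Set) where

  Reaches : S → A → Set
  Reaches s a = ∃[ s′ ] Silent σ s s′ × R s′ a

  -- A `go` must cost σ at least one step: otherwise an infinite run of τ could be matched by a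
  -- finite one of σ.
  Matches : S → Move A → Set
  Matches s (stop k) = ∃[ s′ ] Silent σ s s′ × σ s′ ≡ stop k
  Matches s (go a)   = ∃[ s₁ ] σ s ≡ go s₁ × Reaches s₁ a
  Matches s (ask e m a↓ a↑) =
    ∃[ s′ ] ∃[ s↓ ] ∃[ s↑ ] Silent σ s s′ × σ s′ ≡ ask e m s↓ s↑ × Reaches s↓ a↓ × Reaches s↑ a↑

  module _ (match : ∀ {s a} → R s a → Matches s (τ a)) {C : Graph} where

    private
      -- The first transition is kept apart from the others because infinite runs of σ are built
      -- from it.
      forth : ∀ {s a a′} → R s a → Trans C τ a a′ →
              ∃[ s₁ ] Trans C σ s s₁ × (∃[ s′ ] Star (Trans C σ) s₁ s′ × R s′ a′)
      forth {s} {a} r t with match r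
      forth r (silent eq) | m rewrite eq with m
      ... | s₁ , eq₁ , s′ , p , r′ = s₁ , silent eq₁ , s′ , silent⇒trans p , r′
      forth r (answered↓ eq c) | m rewrite eq with m
      ... | _ , s↓ , _ , ε , eq₁ , (s′ , q , r′) , _ = s↓ , answered↓ eq₁ c , s′ , silent⇒trans q , r′
      ... | _ , s↓ , _ , x ◅ p , eq₁ , (s′ , q , r′) , _ =
        _ , silent x , s′ , silent⇒trans p ◅◅ (answered↓ eq₁ c ◅ silent⇒trans q) , r′
      forth r (answered↑ eq c) | m rewrite eq with m
      ... | _ , _ , s↑ , ε , eq₁ , _ , (s′ , q , r′) = s↑ , answered↑ eq₁ c , s′ , silent⇒trans q , r′
      ... | _ , _ , s↑ , x ◅ p , eq₁ , _ , (s′ , q , r′) =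
        _ , silent x , s′ , silent⇒trans p ◅◅ (answered↑ eq₁ c ◅ silent⇒trans q) , r′

      forth* : ∀ {s a a′ k} → R s a → Star (Trans C τ) a a′ → τ a′ ≡ stop k →
               Behaviour C σ s (↓ k)
      forth* r ε eq with match r
      ... | m rewrite eq with m
      ... | s′ , p , eq′ = s′ , silent⇒trans p , eq′
      forth* r (t ◅ ts) eq with forth r t
      ... | s₁ , t₁ , s′ , p , r′ with forth* r′ ts eq
      ... | h , q , eq′ = h , t₁ ◅ (p ◅◅ q) , eq′

    implement : ∀ {s a r} → Reaches s a → Behaviour C τ a r → Behaviour C σ s r
    implement {r = ↓ k} (s′ , p , rel) (a′ , ts , eq) with forth* rel ts eq
    ... | h , q , eq′ = h , silent⇒trans p ◅◅ q , eq′
    implement {r = ↑} (s′ , p , rel) (run , refl , steps) =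
      unfold-run advance (s′ , 0 , silent⇒trans p , rel)
      where
      Inv : S → Set
      -- A state of σ may lie in the middle of the block that carries out one move of τ; the
      -- remaining path to the end of the block is recorded.
      Inv s = ∃[ s′ ] ∃[ n ] Star (Trans C σ) s s′ × R s′ (run n)
      advance : ∀ {s} → Inv s → ∃[ s′ ] Trans C σ s s′ × Inv s′
      advance (_ , n , t ◅ q , rel) = _ , t , _ , n , q , rel
      advance (_ , n , ε , rel) with forth rel (steps n)
      ... | s₁ , t , s′ , q , rel′ = s₁ , t , s′ , suc n , q , rel′

    private
      back : ∀ {s a h k} → Star (Trans C σ) s h → σ h ≡ stop k → Reaches s a →
             Behaviour C τ a (↓ k)
      committed : ∀ {s a h k} {mv : Move A} → τ a ≡ mv → Star (Trans C σ) s h → σ h ≡ stop k →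
                  Matches s mv → Behaviour C τ a (↓ k)

      back ts eq (_ , ε , rel) = committed refl ts eq (match rel)
      back ε eq (_ , x ◅ p , rel) with () ← trans (sym eq) x
      back (t ◅ ts) eq (_ , x ◅ p , rel) with refl ← trans-go x t = back ts eq (_ , p , rel)

      committed {mv = stop k′} eqₐ ε eq (_ , ε , eq′) with refl ← trans (sym eq) eq′ = _ , ε , eqₐ
      committed {mv = stop k′} eqₐ (t ◅ ts) eq (_ , ε , eq′) = ⊥-elim (trans-stop eq′ t)
      committed {mv = stop k′} eqₐ ε eq (_ , x ◅ p , eq′) with () ← trans (sym eq) x
      committed {mv = stop k′} eqₐ (t ◅ ts) eq (s′ , x ◅ p , eq′)
        with refl ← trans-go x t = committed eqₐ ts eq (s′ , p , eq′)
      committed {mv = go a′} eqₐ ε eq (s₁ , x , rest) with () ← trans (sym eq) x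
      committed {mv = go a′} eqₐ (t ◅ ts) eq (s₁ , x , rest) with refl ← trans-go x t =
        cons-behaviour {r = ↓ _} (silent eqₐ) (back ts eq rest)
      committed {mv = ask e m a↓ a↑} eqₐ ε eq (_ , _ , _ , ε , x , _) with () ← trans (sym eq) x
      committed {mv = ask e m a↓ a↑} eqₐ (t ◅ ts) eq (_ , _ , _ , ε , x , r↓ , r↑) with trans-ask x t
      ... | inj₁ (_ , c , refl) = cons-behaviour {r = ↓ _} (answered↓ eqₐ c) (back ts eq r↓)
      ... | inj₂ (c , refl)     = cons-behaviour {r = ↓ _} (answered↑ eqₐ c) (back ts eq r↑)
      committed {mv = ask e m a↓ a↑} eqₐ ε eq (_ , _ , _ , x ◅ p , _) with () ← trans (sym eq) x
      committed {mv = ask e m a↓ a↑} eqₐ (t ◅ ts) eq (_ , _ , _ , x ◅ p , rest)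
        with refl ← trans-go x t = committed eqₐ ts eq (_ , _ , _ , p , rest)

    -- A silent state has only one successor, so every run of σ is forced through the states
    -- predicted by `match`. At a query both runs take the branch of the same answer.
    abstraction : ∀ {s a r} → Reaches s a → Behaviour C σ s r → Behaviour C τ a r
    abstraction {r = ↓ k} rel (h , ts , eq) = back ts eq rel
    abstraction {s} {r = ↑} rel (run , refl , steps) = unfold-run advance (0 , rel)
      where
      walk : ∀ {n s s′} → run n ≡ s → Silent σ s s′ → ∃[ n′ ] run n′ ≡ s′
      walk {n} eq ε = n , eq
      walk {n} refl (x ◅ p) = walk (trans-go x (steps n)) p
      advance : ∀ {a} → ∃[ n ] Reaches (run n) a →
                ∃[ a′ ] Trans C τ a a′ × (∃[ n ] Reaches (run n) a′)
      advance {a} (n , s′ , p , rel) with walk {n} refl p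
      ... | n′ , refl with τ a in eqₐ | match rel
      ... | stop k | s″ , q , eq with walk {n′} refl q
      ... | n″ , refl = ⊥-elim (trans-stop eq (steps n″))
      advance {a} (n , s′ , p , rel) | n′ , refl | go a′ | s₁ , eq , rest
        with steps n′ | trans-go eq (steps n′)
      ... | t | eq₁ = a′ , silent eqₐ , suc n′ , subst (λ s → Reaches s a′) (sym eq₁) rest
      advance {a} (n , s′ , p , rel) | n′ , refl | ask e m a↓ a↑ | s″ , s↓ , s↑ , q , eq , r↓ , r↑
        with walk {n′} refl q
      ... | n″ , refl with trans-ask eq (steps n″)
      ... | inj₁ (_ , c , eq₁) = a↓ , answered↓ eqₐ c , suc n″ , subst (λ s → Reaches s a↓) (sym eq₁) r↓
      ... | inj₂ (c , eq₁)     = a↑ , answered↑ eqₐ c , suc n″ , subst (λ s → Reaches s a↑) (sym eq₁) r↑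

-- Machine programs as transition systems, and induction over `I∞`

embed : ℕ → Next → Move Config
embed k stop              = stop k
embed k (go c)            = go c
embed k (ask e′ m′ c↓ c↑) = ask e′ m′ c↓ c↑

machine : Program → Oracle → System Config
machine P X c = embed (output c) (next P X c)

module _ {X : Oracle} {C : Graph} {P : Program} where
  private
    embed-go : ∀ {k c} n → embed k n ≡ go c → n ≡ go c
    embed-go (go c) refl = refl
    embed-ask : ∀ {k e m c↓ c↑} n → embed k n ≡ ask e m c↓ c↑ → n ≡ ask e m c↓ c↑
    embed-ask (ask _ _ _ _) refl = refl

  step⇒trans : ∀ {c c′} → Step C P X c c′ → Trans C (machine P X) c c′
  step⇒trans (plain eq)       = silent (cong (embed _) eq)
  step⇒trans (answered↓ eq x) = answered↓ (cong (embed _) eq) x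
  step⇒trans (answered↑ eq x) = answered↑ (cong (embed _) eq) x

  trans⇒step : ∀ {c c′} → Trans C (machine P X) c c′ → Step C P X c c′
  trans⇒step (silent eq)      = plain (embed-go _ eq)
  trans⇒step (answered↓ eq x) = answered↓ (embed-ask _ eq) x
  trans⇒step (answered↑ eq x) = answered↑ (embed-ask _ eq) x

module _ {X : Oracle} {C : Graph} {e m : ℕ} where
  I⇒behaviour : ∀ {r} → I X C e m r → Behaviour C (machine (program e) X) (initial m) r
  I⇒behaviour {↓ k} (c , p , eq , refl) = c , gmap (λ c → c) step⇒trans p , cong (embed _) eq
  I⇒behaviour {↑} (run , eq , steps) = run , eq , λ n → step⇒trans (steps n)

  behaviour⇒I : ∀ {r} → Behaviour C (machine (program e) X) (initial m) r → I X C e m r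
  behaviour⇒I {↓ k} (c , p , eq) with embed-stop _ eq
    where
    embed-stop : ∀ {k k′} n → embed k n ≡ stop k′ → n ≡ stop × k ≡ k′
    embed-stop stop refl = refl , refl
  ... | eq₁ , eq₂ = c , gmap (λ c → c) trans⇒step p , eq₁ , eq₂
  behaviour⇒I {↑} (run , eq , steps) = run , eq , λ n → trans⇒step (steps n)

module _ {X : Oracle} where

  -- `I∞` is nested inside `Star` and inside the steps of infinite runs. Mapping over these is
  -- defined mutually with `rec`, so that the recursion is seen to descend. The hypothesis keeps the
  -- derivation of each answer beside D.
  I∞-induction : (D : Graph) →
    (∀ {e m r} → I X (λ e m r → I∞ X e m r × D e m r) e m r → D e m r) →
    ∀ {e m r} → I∞ X e m r → D e m r
  I∞-induction D f = rec
    where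
    C : Graph
    C e m r = I∞ X e m r × D e m r
    rec : ∀ {e m r} → I∞ X e m r → D e m r
    recStep : ∀ {P c c′} → Step (I∞ X) P X c c′ → Step C P X c c′
    recStar : ∀ {P c c′} → Star (Step (I∞ X) P X) c c′ → Star (Step C P X) c c′

    rec {r = ↓ k} (closed (c , p , eqs)) = f (c , recStar p , eqs)
    rec {r = ↑} (closed (run , eq , steps)) = f (run , eq , λ n → recStep (steps n))
    recStep (plain eq) = plain eq
    recStep (answered↓ eq x) = answered↓ eq (x , rec x)
    recStep (answered↑ eq x) = answered↑ eq (x , rec x)
    recStar ε = ε
    recStar (s ◅ p) = recStep s ◅ recStar p

  -- By induction on the first derivation the two runs receive the same answers, hence are the same
  -- run.
  I∞-functional : ∀ {e m r r′} → I∞ X e m r → I∞ X e m r′ → r ≡ r′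
  I∞-functional x y = I∞-induction D (λ {e} {m} {r} → unique {e} {m} {r}) x _ y
    where
    D : Graph
    D e m r = ∀ r′ → I∞ X e m r′ → r ≡ r′
    C : Graph
    C e m r = I∞ X e m r × D e m r
    module _ {P : Program} where
      deterministic : ∀ {c c₁ c₂} → Step C P X c c₁ → Step (I∞ X) P X c c₂ → c₁ ≡ c₂
      deterministic s t with step⇒trans s | step⇒trans t
      ... | silent eq | t′ = sym (trans-go eq t′)
      ... | answered↓ eq (_ , d) | t′ with trans-ask eq t′
      ... | inj₁ (_ , _ , eq′) = sym eq′
      ... | inj₂ (c , _) with () ← d _ c
      deterministic s t | answered↑ eq (_ , d) | t′ with trans-ask eq t′
      ... | inj₁ (_ , c , _) with () ← d _ c
      ... | inj₂ (c , eq′) = sym eq′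

      stopped : ∀ {c c′} {C′ : Graph} → next P X c ≡ stop → ¬ Step C′ P X c c′
      stopped eq s = trans-stop (cong (embed _) eq) (step⇒trans s)

      follow : ∀ {c h h′} → Star (Step C P X) c h → next P X h ≡ stop →
               Star (Step (I∞ X) P X) c h′ → next P X h′ ≡ stop → h ≡ h′
      follow ε eq ε eq′ = refl
      follow ε eq (t ◅ _) eq′ = ⊥-elim (stopped eq t)
      follow (s ◅ _) eq ε eq′ = ⊥-elim (stopped eq′ s)
      follow (s ◅ p) eq (t ◅ q) eq′ with refl ← deterministic s t = follow p eq q eq′

      endless : ∀ {c h} {run : ℕ → Config} → Star (Step C P X) c h → next P X h ≡ stop →
                ∀ n → c ≡ run n → ¬ (∀ n → Step (I∞ X) P X (run n) (run (suc n)))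
      endless ε eq n refl steps = stopped eq (steps n)
      endless (s ◅ p) eq n refl steps = endless p eq (suc n) (deterministic s (steps n)) steps

      endless′ : ∀ {c h} {run : ℕ → Config} → Star (Step (I∞ X) P X) c h → next P X h ≡ stop →
                 ∀ n → run n ≡ c → ¬ (∀ n → Step C P X (run n) (run (suc n)))
      endless′ ε eq n refl steps = stopped eq (steps n)
      endless′ (s ◅ p) eq n refl steps = endless′ p eq (suc n) (deterministic (steps n) s) steps

    unique : ∀ {e m r} → I X C e m r → D e m r
    unique {r = ↓ k} (c , p , eq , refl) (↓ k′) (closed (c′ , p′ , eq′ , refl))
      with refl ← follow p eq p′ eq′ = refl
    unique {r = ↓ k} (c , p , eq , _) ↑ (closed (run , eq′ , steps)) =
      ⊥-elim (endless p eq 0 (sym eq′) steps)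
    unique {r = ↑} (run , eq′ , steps) (↓ k) (closed (c , p , eq , _)) =
      ⊥-elim (endless′ p eq 0 eq′ steps)
    unique {r = ↑} _ ↑ _ = refl

-- Counter programs and their translation into machine programs

-- Counter programs; tape i holds counter i, in unary to the right of its head.

Reg : Set
Reg = Fin 6

Regs : Set
Regs = Vec ℕ 6

data Cmd : Set where
  skip    : Cmd
  inc dec : Reg → Cmd
  _∙_     : Cmd → Cmd → Cmd
  while   : Reg → Cmd → Cmd
  ifz     : Reg → Cmd → Cmd → Cmd
  -- Increment the last register if the answer is 1 or ↓.
  consult : Reg → Reg → Cmd
  query   : Reg → Reg → Reg → Cmd

infixr 5 _∙_

-- The summands are ordered so that the exit `size cmd + p` of a command placed at p agrees with the
-- exit of its last part up to associativity.
size : Cmd → ℕ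
size skip          = 0
size (inc r)       = 2
size (dec r)       = 1
size (c ∙ d)       = size d + size c
size (while r c)   = 2 + size c
size (ifz r c d)   = size d + (2 + size c)
size (consult r q) = 3
size (query r q s) = 3

jump : ℕ → Instruction
jump q = act 0 (action blank stay q) (action stroke stay q)

test : Reg → ℕ → ℕ → Instruction
test r q₀ q₁ = act (toℕ r) (action blank stay q₀) (action stroke stay q₁)

-- Only cells from the head rightwards count, so a number grows by a stroke put in front of it,
-- overwriting whatever stood there; `dec` likewise just steps over a stroke.
increment : ℕ → Reg → List Instruction
increment p r =
  act (toℕ r) (action blank left (1 + p)) (action stroke left (1 + p)) ∷
  act (toℕ r) (action stroke stay (2 + p)) (action stroke stay (2 + p)) ∷ []

assemble : ℕ → Cmd → List Instruction
assemble p skip          = []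
assemble p (inc r)       = increment p r
assemble p (dec r)       =
  act (toℕ r) (action blank stay (1 + p)) (action stroke right (1 + p)) ∷ []
assemble p (c ∙ d)       = assemble p c ++ assemble (size c + p) d
assemble p (while r c)   =
  test r (2 + size c + p) (1 + p) ∷ assemble (1 + p) c ++ jump p ∷ []
assemble p (ifz r c d)   =
  test r (1 + p) (2 + size c + p) ∷
  assemble (1 + p) c ++ jump (size d + (2 + size c + p)) ∷ assemble (2 + size c + p) d
assemble p (consult r q) = oracle (toℕ r) (3 + p) (1 + p) ∷ increment (1 + p) q
assemble p (query r q s) = query (toℕ r) (toℕ q) (1 + p) (3 + p) ∷ increment (1 + p) s

length-assemble : ∀ p c → length (assemble p c) ≡ size c
length-assemble p skip = refl
length-assemble p (inc r) = refl
length-assemble p (dec r) = refl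
length-assemble p (c ∙ d) = trans (length-++ (assemble p c))
  (trans (cong₂ _+_ (length-assemble p c) (length-assemble (size c + p) d)) (+-comm (size c) (size d)))
length-assemble p (while r c) = cong suc (trans (length-++ (assemble (1 + p) c))
  (trans (+-comm _ 1) (cong suc (length-assemble (1 + p) c))))
length-assemble p (ifz r c d) = trans (cong suc (trans (length-++ (assemble (1 + p) c))
  (cong₂ (λ i j → i + suc j) (length-assemble (1 + p) c) (length-assemble (2 + size c + p) d))))
  (trans (cong suc (+-suc (size c) (size d))) (+-comm (2 + size c) (size d)))
length-assemble p (consult r q) = refl
length-assemble p (query r q s) = refl

_∋_at_ : Program → List Instruction → ℕ → Set
P ∋ [] at p       = ⊤
P ∋ (i ∷ is) at p = fetch P p ≡ i × P ∋ is at (suc p)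

at-++ : ∀ {P p} is {js} → P ∋ (is ++ js) at p → P ∋ is at p × P ∋ js at (length is + p)
at-++ [] a = tt , a
at-++ {P} {p} (i ∷ is) {js} (f , a) with at-++ {P} {suc p} is a
... | b , c = (f , b) , subst (P ∋ js at_) (+-suc (length is) p) c

fetch-drop : ∀ {P : Program} {i is} p → drop p P ≡ i ∷ is → fetch P p ≡ i × drop (suc p) P ≡ is
fetch-drop {i ∷ P} zero refl = refl , refl
fetch-drop {j ∷ P} (suc p) eq = fetch-drop {P} p eq

drop⇒at : ∀ {P} p is → drop p P ≡ is → P ∋ is at p
drop⇒at p [] eq = tt
drop⇒at {P} p (i ∷ is) eq with fetch-drop {P} p eq
... | f , eq′ = f , drop⇒at (suc p) is eq′

fetch-end : ∀ P → fetch P (length P) ≡ halt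
fetch-end [] = refl
fetch-end (i ∷ P) = fetch-end P

-- Wrapped in a record so that the command and the position can be inferred; the bare type would
-- unfold to a product of fetches.
record _contains_at_ (P : Program) (c : Cmd) (p : ℕ) : Set where
  constructor contains
  field
    instructions : P ∋ assemble p c at p
open _contains_at_ public

at-∙ : ∀ {P p c d} → P contains (c ∙ d) at p → P contains c at p × P contains d at (size c + p)
at-∙ {P} {p} {c} {d} (contains a) with at-++ {P} (assemble p c) a
... | b , e = contains b , contains (subst (λ n → P ∋ assemble (size c + p) d at (n + p)) (length-assemble p c) e)

at-while : ∀ {P p r c} → P contains (while r c) at p →
           fetch P p ≡ test r (2 + size c + p) (1 + p) ×
           P contains c at (1 + p) ×
           fetch P (size c + (1 + p)) ≡ jump p
at-while {P} {p} {r} {c} (contains (f , a)) with at-++ {P} (assemble (1 + p) c) a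
... | b , (j , _) = f , contains b , subst (λ n → fetch P (n + (1 + p)) ≡ jump p) (length-assemble (1 + p) c) j

at-ifz : ∀ {P p r c d} → P contains (ifz r c d) at p →
         fetch P p ≡ test r (1 + p) (2 + size c + p) ×
         P contains c at (1 + p) ×
         fetch P (size c + (1 + p)) ≡ jump (size d + (2 + size c + p)) ×
         P contains d at (2 + size c + p)
at-ifz {P} {p} {r} {c} {d} (contains (f , a)) with at-++ {P} (assemble (1 + p) c) a
... | b , (j , e) = f , contains b
  , subst (λ n → fetch P (n + (1 + p)) ≡ jump (size d + (2 + size c + p))) (length-assemble (1 + p) c) j
  , contains (subst (P ∋ assemble (2 + size c + p) d at_)
      (trans (cong (λ n → suc (n + suc p)) (length-assemble (1 + p) c)) (cong suc (+-suc (size c) p))) e)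

record Holds (c : Config) (p : ℕ) (v : Regs) : Set where
  constructor holds
  field
    position : Config.state c ≡ p
    values   : ∀ i → value (Config.tapes c (toℕ i)) ≡ lookup v i
open Holds

updated : ∀ (τs : ℕ → Tape) t τ → (τs [ t ]≔ τ) t ≡ τ
updated τs t τ rewrite dec-true (t ≟ t) refl = refl

unchanged : ∀ (τs : ℕ → Tape) t τ {u} → u ≢ t → (τs [ t ]≔ τ) u ≡ τs u
unchanged τs t τ {u} u≢t rewrite dec-false (u ≟ t) u≢t = refl

value-stay : ∀ τ s → Tape.scanned τ ≡ s → shift stay (record τ { scanned = s }) ≡ τ
value-stay τ s refl = refl

value-inc : ∀ τ s → Tape.scanned τ ≡ s →
  value (shift stay (record (shift left (record τ { scanned = s })) { scanned = stroke })) ≡ suc (value τ)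
value-inc (tape [] s as) _ refl = refl
value-inc (tape (b ∷ bs) s as) _ refl = refl

value-right : ∀ τ s → Tape.scanned τ ≡ stroke → value (shift right (record τ { scanned = s })) ≡ pred (value τ)
value-right (tape bs .stroke [])       s refl = refl
value-right (tape bs .stroke (a ∷ as)) s refl = refl

value-blank : ∀ τ → Tape.scanned τ ≡ blank → value τ ≡ 0
value-blank (tape bs .blank as) refl = refl

symbol-cases : ∀ s → s ≡ blank ⊎ s ≡ stroke
symbol-cases blank  = inj₁ refl
symbol-cases stroke = inj₂ refl

module Execution (P : Program) (X : Oracle) where

  σ : System Config
  σ = machine P X

  step : ∀ c {p i n} → Config.state c ≡ p → fetch P p ≡ i →
         execute X i (Config.tapes c) ≡ go n → σ c ≡ go n
  step (config q τs) refl f eq rewrite f | eq = refl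

  Leads : Config → ℕ → Regs → Set
  Leads c p v = ∃[ c′ ] Silent σ c c′ × Holds c′ p v

  -- At least one step is taken, as `Matches` demands of `go`.
  Leads⁺ : Config → ℕ → Regs → Set
  Leads⁺ c p v = ∃[ c₁ ] σ c ≡ go c₁ × Leads c₁ p v

  leads : ∀ {c p v} → Leads⁺ c p v → Leads c p v
  leads (_ , eq , c′ , s , h) = c′ , eq ◅ s , h

  _then_ : ∀ {c p q v w} → Leads c p v → (∀ {c′} → Holds c′ p v → Leads c′ q w) → Leads c q w
  (c′ , s , h) then f with f h
  ... | c″ , s′ , h′ = c″ , s ◅◅ s′ , h′

  infixl 4 _then_

  perform-holds : ∀ {c p v w} (r : Reg) s d q →  Holds c p v →
    value (shift d (record (Config.tapes c (toℕ r)) { scanned = s })) ≡ lookup w r →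
    (∀ i → i ≢ r → lookup w i ≡ lookup v i) →
    Holds (perform (toℕ r) (action s d q) (Config.tapes c)) q w
  perform-holds {c} r s d q (holds pos val) new old = holds refl vals
    where
    vals : ∀ i → _ ≡ _
    vals i with i ≟ᶠ r
    ... | yes refl = trans (cong value (updated (Config.tapes c) (toℕ r) _)) new
    ... | no i≢r = trans (cong value (unchanged (Config.tapes c) (toℕ r) _ (λ eq → i≢r (toℕ-injective eq))))
                     (trans (val i) (sym (old i i≢r)))

  choose-as : ∀ {c p v a b} (r : Reg) s → Holds c p v → fetch P p ≡ act (toℕ r) a b →
    Tape.scanned (Config.tapes c (toℕ r)) ≡ s → σ c ≡ go (perform (toℕ r) (choose s a b) (Config.tapes c))
  choose-as {c} {a = a} {b} r s h f eq =
    step c (position h) f (cong (λ s → go (perform (toℕ r) (choose s a b) (Config.tapes c))) eq)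

  run-jump : ∀ {c p q v} → fetch P p ≡ jump q → Holds c p v → Leads⁺ c q v
  run-jump {c} f h with symbol-cases (Tape.scanned (Config.tapes c 0))
  ... | inj₁ eq = _ , choose-as zero blank h f eq , _ , ε
               , perform-holds zero blank stay _ h (trans (cong value (value-stay (Config.tapes c _) _ eq)) (values h zero)) λ _ _ → refl
  ... | inj₂ eq = _ , choose-as zero stroke h f eq , _ , ε
               , perform-holds zero stroke stay _ h (trans (cong value (value-stay (Config.tapes c _) _ eq)) (values h zero)) λ _ _ → refl

  scanned-zero : ∀ {c p v} (r : Reg) → Holds c p v → lookup v r ≡ 0 →
                 Tape.scanned (Config.tapes c (toℕ r)) ≡ blank
  scanned-zero {c} r h z with Config.tapes c (toℕ r) | values h r
  ... | tape _ blank _  | _ = refl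
  ... | tape _ stroke _ | eq with () ← trans eq z

  scanned-suc : ∀ {c p v n} r → Holds c p v → lookup v r ≡ suc n →
                Tape.scanned (Config.tapes c (toℕ r)) ≡ stroke
  scanned-suc {c} r h z with Config.tapes c (toℕ r) | values h r
  ... | tape _ stroke _ | _ = refl
  ... | tape _ blank _  | eq with () ← trans eq z

  run-test-zero : ∀ {c p q₀ q₁ v} (r : Reg) → fetch P p ≡ test r q₀ q₁ → lookup v r ≡ 0 →
                  Holds c p v → Leads⁺ c q₀ v
  run-test-zero {c} r f z h = _ , choose-as r blank h f eq , _ , ε
    , perform-holds r blank stay _ h (trans (cong value (value-stay (Config.tapes c _) _ eq)) (values h r)) λ _ _ → refl
    where eq = scanned-zero r h z

  run-test-suc : ∀ {c p q₀ q₁ v n} (r : Reg) → fetch P p ≡ test r q₀ q₁ → lookup v r ≡ suc n →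
                 Holds c p v → Leads⁺ c q₁ v
  run-test-suc {c} r f z h = _ , choose-as r stroke h f eq , _ , ε
    , perform-holds r stroke stay _ h (trans (cong value (value-stay (Config.tapes c _) _ eq)) (values h r)) λ _ _ → refl
    where eq = scanned-suc r h z

  run-inc : ∀ {c p v} r → P ∋ increment p r at p → Holds c p v → Leads⁺ c (2 + p) (updateAt v r suc)
  run-inc {c} {p} {v} r (f₁ , f₂ , _) h = c₁ , moved , c₂ , written ◅ ε ,
      holds refl vals
    where
    τs = Config.tapes c
    t  = toℕ r
    c₁ : Config
    c₁ = perform t (action (Tape.scanned (τs t)) left (1 + p)) τs
    c₂ : Config
    c₂ = perform t (action stroke stay (2 + p)) (Config.tapes c₁)
    moved : σ c ≡ go c₁
    moved = trans (choose-as r (Tape.scanned (τs t)) h f₁ refl)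
                  (cong (λ a → go (perform t a τs)) (choose-same (Tape.scanned (τs t))))
      where
      choose-same : ∀ s → choose s (action blank left (1 + p)) (action stroke left (1 + p)) ≡ action s left (1 + p)
      choose-same blank  = refl
      choose-same stroke = refl
    written : σ c₁ ≡ go c₂
    written with symbol-cases (Tape.scanned (Config.tapes c₁ t))
    ... | inj₁ eq = step c₁ refl f₂ (cong (λ s → go (perform t (choose s _ _) (Config.tapes c₁))) eq)
    ... | inj₂ eq = step c₁ refl f₂ (cong (λ s → go (perform t (choose s _ _) (Config.tapes c₁))) eq)
    vals : ∀ i → value (Config.tapes c₂ (toℕ i)) ≡ lookup (updateAt v r suc) i
    vals i with i ≟ᶠ r
    ... | yes refl = trans (cong value (trans (updated (Config.tapes c₁) t _)
                       (cong (λ τ → shift stay (record τ { scanned = stroke })) (updated τs t _))))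
                     (trans (value-inc (τs t) _ refl)
                       (trans (cong suc (values h r)) (sym (lookup∘updateAt r v))))
    ... | no i≢r = trans (cong value (trans (unchanged (Config.tapes c₁) t _ (λ e → i≢r (toℕ-injective e)))
                           (unchanged τs t _ (λ e → i≢r (toℕ-injective e)))))
                     (trans (values h i) (sym (lookup∘updateAt′ i r i≢r v)))

  run-dec : ∀ {c p v} r → P contains dec r at p → Holds c p v → Leads c (1 + p) (updateAt v r pred)
  run-dec {c} {p} {v} r (contains (f , _)) h with symbol-cases (Tape.scanned (Config.tapes c (toℕ r)))
  ... | inj₁ eq = _ , choose-as r blank h f eq ◅ ε
    , perform-holds r blank stay _ h
        (trans (cong value (value-stay (Config.tapes c _) _ eq)) (trans (value-blank (Config.tapes c (toℕ r)) eq) (sym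
          (trans (lookup∘updateAt r v) (cong pred (trans (sym (values h r)) (value-blank (Config.tapes c (toℕ r)) eq)))))))
        λ i i≢r → lookup∘updateAt′ i r i≢r v
  ... | inj₂ eq = _ , choose-as r stroke h f eq ◅ ε
    , perform-holds r stroke right _ h
        (trans (value-right (Config.tapes c (toℕ r)) _ eq) (sym (trans (lookup∘updateAt r v) (cong pred (sym (values h r))))))
        λ i i≢r → lookup∘updateAt′ i r i≢r v

-- There is no rule for query, which only the loop of Loop executes.
data Exec (X : Oracle) : Cmd → Regs → Regs → Set where
  skip     : ∀ {v} → Exec X skip v v
  inc      : ∀ {r v} → Exec X (inc r) v (updateAt v r suc)
  dec      : ∀ {r v} → Exec X (dec r) v (updateAt v r pred)
  _∙_      : ∀ {c d u v w} → Exec X c u v → Exec X d v w → Exec X (c ∙ d) u w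
  while0   : ∀ {r c v} → lookup v r ≡ 0 → Exec X (while r c) v v
  while+   : ∀ {r c u v w n} → lookup u r ≡ suc n → Exec X c u v →
             Exec X (while r c) v w → Exec X (while r c) u w
  ifz0     : ∀ {r c d v w} → lookup v r ≡ 0 → Exec X c v w → Exec X (ifz r c d) v w
  ifz+     : ∀ {r c d v w n} → lookup v r ≡ suc n → Exec X d v w → Exec X (ifz r c d) v w
  consult0 : ∀ {r q v} → X (lookup v r) ≡ false → Exec X (consult r q) v v
  consult1 : ∀ {r q v} → X (lookup v r) ≡ true → Exec X (consult r q) v (updateAt v q suc)

module _ {P : Program} {X : Oracle} where
  open Execution P X

  run : ∀ {cmd p v w c} → Exec X cmd v w → P contains cmd at p → Holds c p v → Leads c (size cmd + p) w
  run skip a h = _ , ε , h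
  run (inc {r}) a h = leads (run-inc r (instructions a) h)
  run (dec {r}) a h = run-dec r a h
  run {p = p} {w = w} {κ} (_∙_ {c} {d} x y) a h with at-∙ a
  ... | b , e = subst (λ n → Leads κ n w) (sym (+-assoc (size d) (size c) p)) (run x b h then run y e)
  run (while0 {r} {c} z) a h with at-while a
  ... | f , _ = leads (run-test-zero r f z h)
  run {w = w} {κ} (while+ {r} {c} z x y) a h with at-while a
  ... | f , b , j = leads (run-test-suc r f z h) then run x b then (λ h → leads (run-jump j h)) then run y a
  run {p = p} {w = w} {κ} (ifz0 {r} {c} {d} z x) a h with at-ifz a
  ... | f , b , j , e = subst (λ n → Leads κ n w) (sym (+-assoc (size d) (2 + size c) p))
    (leads (run-test-zero r f z h) then run x b then (λ h → leads (run-jump j h)))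
  run {p = p} {w = w} {κ} (ifz+ {r} {c} {d} z x) a h with at-ifz a
  ... | f , b , j , e = subst (λ n → Leads κ n w) (sym (+-assoc (size d) (2 + size c) p))
    (leads (run-test-suc r f z h) then run x e)
  run {p = p} {c = κ} (consult0 {r} {q} eq) (contains (f , a)) h =
    _ , step κ (position h) f (cong branch (trans (cong X (values h r)) eq)) ◅ ε , holds refl (values h)
    where
    branch : Bool → Next
    branch b = go (config (if b then 1 + p else 3 + p) (Config.tapes κ))
  run {p = p} {c = κ} (consult1 {r} {q} {v} eq) (contains (f , a)) h =
    leads {κ} consulted then λ h → leads (run-inc q a h)
    where
    branch : Bool → Next
    branch b = go (config (if b then 1 + p else 3 + p) (Config.tapes κ))
    consulted : Leads⁺ κ (1 + p) v
    consulted = _ , step κ (position h) f (cong branch (trans (cong X (values h r)) eq)) , _ , ε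
      , holds refl (values h)

-- Counter programs for pairing and for a stack

pattern Acc = zero
pattern Stk = suc zero
pattern Dat = suc (suc zero)
pattern Tmp = suc (suc (suc zero))
pattern Tag = suc (suc (suc (suc zero)))
pattern Arg = suc (suc (suc (suc (suc zero))))

⟨_,_,_,_,_,_⟩ : (a s d t g h : ℕ) → Regs
⟨ a , s , d , t , g , h ⟩ = a ∷ s ∷ d ∷ t ∷ g ∷ h ∷ []

clear : Reg → Cmd
clear r = while r (dec r)

transfer : Reg → Reg → Cmd
transfer r q = while r (dec r ∙ inc q)

transfer₂ : Reg → Reg → Reg → Cmd
transfer₂ r q q′ = while r (dec r ∙ inc q ∙ inc q′)

exchange : Reg → Reg → Cmd
exchange r q = transfer r Tmp ∙ transfer q r ∙ transfer Tmp q

-- Replace Dat and Stk by 0 and their pair.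
push : Cmd
push = transfer₂ Dat Stk Tmp
     ∙ while Stk (dec Stk ∙ inc Tmp ∙ transfer₂ Stk Dat Tmp ∙ transfer Dat Stk)
     ∙ transfer Tmp Stk

advance : Cmd
advance = ifz Stk (transfer Dat Stk ∙ inc Stk) (dec Stk ∙ inc Dat)

-- Runs the recursion that defines `unpair`: `advance` is `nextPair` on Dat and Stk, started at (0 ,
-- 0).
pop : Cmd
pop = transfer Stk Tmp ∙ while Tmp (dec Tmp ∙ advance)

split : Cmd
split = exchange Acc Stk ∙ pop ∙ exchange Acc Stk

join : Cmd
join = exchange Acc Stk ∙ push ∙ exchange Acc Stk

copy : Cmd
copy = transfer₂ Acc Dat Tmp ∙ transfer Tmp Acc

module _ {X : Oracle} where

  rewriteʳ : ∀ {c v w w′} → w ≡ w′ → Exec X c v w → Exec X c v w′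
  rewriteʳ refl e = e

  -- The argument f shows the state as a function of the registers that change.
  clear-exec : ∀ {r} (f : ℕ → Regs) → (∀ x → lookup (f x) r ≡ x) →
    (∀ x → updateAt (f (suc x)) r pred ≡ f x) → ∀ x → Exec X (clear r) (f x) (f 0)
  clear-exec f look upd zero = while0 (look 0)
  clear-exec {r} f look upd (suc x) = while+ (look (suc x)) (rewriteʳ (upd x) dec) (clear-exec f look upd x)

  transfer-exec : ∀ {r q} (f : ℕ → ℕ → Regs) → (∀ x y → lookup (f x y) r ≡ x) →
    (∀ x y → updateAt (updateAt (f (suc x) y) r pred) q suc ≡ f x (suc y)) →
    ∀ x y → Exec X (transfer r q) (f x y) (f 0 (x + y))
  transfer-exec f look upd zero y = while0 (look 0 y)
  transfer-exec f look upd (suc x) y = while+ (look (suc x) y) (rewriteʳ (upd x y) (dec ∙ inc))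
    (rewriteʳ (cong (f 0) (+-suc x y)) (transfer-exec f look upd x (suc y)))

  transfer-exec₀ : ∀ {r q} (f : ℕ → ℕ → Regs) → (∀ x y → lookup (f x y) r ≡ x) →
    (∀ x y → updateAt (updateAt (f (suc x) y) r pred) q suc ≡ f x (suc y)) →
    ∀ x → Exec X (transfer r q) (f x 0) (f 0 x)
  transfer-exec₀ f look upd x = rewriteʳ (cong (f 0) (+-identityʳ x)) (transfer-exec f look upd x 0)

  transfer₂-exec : ∀ {r q q′} (f : ℕ → ℕ → ℕ → Regs) → (∀ x y z → lookup (f x y z) r ≡ x) →
    (∀ x y z → updateAt (updateAt (updateAt (f (suc x) y z) r pred) q suc) q′ suc ≡ f x (suc y) (suc z)) →
    ∀ x y z → Exec X (transfer₂ r q q′) (f x y z) (f 0 (x + y) (x + z))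
  transfer₂-exec f look upd zero y z = while0 (look 0 y z)
  transfer₂-exec f look upd (suc x) y z = while+ (look (suc x) y z) (rewriteʳ (upd x y z) (dec ∙ inc ∙ inc))
    (rewriteʳ (cong₂ (f 0) (+-suc x y) (+-suc x z)) (transfer₂-exec f look upd x (suc y) (suc z)))

  module _ {g h : ℕ} where

    exchange-AS : ∀ {a s d} → Exec X (exchange Acc Stk) ⟨ a , s , d , 0 , g , h ⟩ ⟨ s , a , d , 0 , g , h ⟩
    exchange-AS {a} {s} {d} =
        transfer-exec₀ (λ x y → ⟨ x , s , d , y , g , h ⟩) (λ _ _ → refl) (λ _ _ → refl) a
      ∙ transfer-exec₀ (λ x y → ⟨ y , x , d , a , g , h ⟩) (λ _ _ → refl) (λ _ _ → refl) s
      ∙ transfer-exec₀ (λ x y → ⟨ s , y , d , x , g , h ⟩) (λ _ _ → refl) (λ _ _ → refl) a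

    exchange-AD : ∀ {a s d} → Exec X (exchange Acc Dat) ⟨ a , s , d , 0 , g , h ⟩ ⟨ d , s , a , 0 , g , h ⟩
    exchange-AD {a} {s} {d} =
        transfer-exec₀ (λ x y → ⟨ x , s , d , y , g , h ⟩) (λ _ _ → refl) (λ _ _ → refl) a
      ∙ transfer-exec₀ (λ x y → ⟨ y , s , x , a , g , h ⟩) (λ _ _ → refl) (λ _ _ → refl) d
      ∙ transfer-exec₀ (λ x y → ⟨ d , s , y , x , g , h ⟩) (λ _ _ → refl) (λ _ _ → refl) a

    -- After the first transfer Stk holds d + s and Tmp holds d. Each round adds the current Stk to
    -- Tmp and lowers Stk by one, giving `triangle (d + s) + d`.
    push-exec : ∀ {a d s} → Exec X push ⟨ a , s , d , 0 , g , h ⟩ ⟨ a , pair d s , 0 , 0 , g , h ⟩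
    push-exec {a} {d} {s} =
        transfer₂-exec (λ x y z → ⟨ a , y , x , z , g , h ⟩) (λ _ _ _ → refl) (λ _ _ _ → refl) d s 0
      ∙ triangles (d + s) (d + 0)
      ∙ rewriteʳ (cong (λ n → ⟨ a , triangle (d + s) + n , 0 , 0 , g , h ⟩) (+-identityʳ d))
          (transfer-exec₀ (λ x y → ⟨ a , y , 0 , x , g , h ⟩) (λ _ _ → refl) (λ _ _ → refl) (triangle (d + s) + (d + 0)))
      where
      arith : ∀ s t → triangle s + (s + suc t) ≡ suc (s + triangle s + t)
      arith s t = trans (cong (triangle s +_) (+-suc s t)) (trans (+-suc (triangle s) (s + t))
        (cong suc (trans (sym (+-assoc (triangle s) s t)) (cong (_+ t) (+-comm (triangle s) s)))))
      triangles : ∀ s t → Exec X (while Stk (dec Stk ∙ inc Tmp ∙ transfer₂ Stk Dat Tmp ∙ transfer Dat Stk))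
        ⟨ a , s , 0 , t , g , h ⟩ ⟨ a , 0 , 0 , triangle s + t , g , h ⟩
      triangles zero t = while0 refl
      triangles (suc s) t = while+ refl
        ( dec ∙ inc
        ∙ transfer₂-exec (λ x y z → ⟨ a , x , y , z , g , h ⟩) (λ _ _ _ → refl) (λ _ _ _ → refl) s 0 (suc t)
        ∙ rewriteʳ (cong (λ n → ⟨ a , n , 0 , s + suc t , g , h ⟩) (+-identityʳ s))
            (transfer-exec₀ (λ x y → ⟨ a , y , x , s + suc t , g , h ⟩) (λ _ _ → refl) (λ _ _ → refl) (s + 0)))
        (rewriteʳ (cong (λ n → ⟨ a , 0 , 0 , n , g , h ⟩) (arith s t)) (triangles s (s + suc t)))

    pop-exec : ∀ {a n} → Exec X pop ⟨ a , n , 0 , 0 , g , h ⟩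
                                    ⟨ a , proj₂ (unpair n) , proj₁ (unpair n) , 0 , g , h ⟩
    pop-exec {a} {n} =
        transfer-exec₀ (λ x y → ⟨ a , x , 0 , y , g , h ⟩) (λ _ _ → refl) (λ _ _ → refl) n
      ∙ rewriteʳ (cong at (+-identityʳ n)) (enumerate n 0)
      where
      at : ℕ → Regs
      at k = ⟨ a , proj₂ (unpair k) , proj₁ (unpair k) , 0 , g , h ⟩
      advance-exec : ∀ p t → Exec X advance ⟨ a , proj₂ p , proj₁ p , t , g , h ⟩
        ⟨ a , proj₂ (nextPair p) , proj₁ (nextPair p) , t , g , h ⟩
      advance-exec (x , zero) t = ifz0 refl
        (transfer-exec₀ (λ x y → ⟨ a , y , x , t , g , h ⟩) (λ _ _ → refl) (λ _ _ → refl) x ∙ inc)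
      advance-exec (x , suc y) t = ifz+ refl (dec ∙ inc)
      enumerate : ∀ n k → Exec X (while Tmp (dec Tmp ∙ advance))
        ⟨ a , proj₂ (unpair k) , proj₁ (unpair k) , n , g , h ⟩ (at (n + k))
      enumerate zero k = while0 refl
      enumerate (suc n) k = while+ refl (dec ∙ advance-exec (unpair k) n)
        (rewriteʳ (cong at (+-suc n k)) (enumerate n (suc k)))

    pop-pair : ∀ {a x y} → Exec X pop ⟨ a , pair x y , 0 , 0 , g , h ⟩ ⟨ a , y , x , 0 , g , h ⟩
    pop-pair {a} {x} {y} = rewriteʳ (cong (λ p → ⟨ a , proj₂ p , proj₁ p , 0 , g , h ⟩) (unpair-pair x y)) pop-exec

    split-pair : ∀ {x y s} → Exec X split ⟨ pair x y , s , 0 , 0 , g , h ⟩ ⟨ y , s , x , 0 , g , h ⟩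
    split-pair = exchange-AS ∙ pop-pair ∙ exchange-AS

    join-exec : ∀ {x y s} → Exec X join ⟨ y , s , x , 0 , g , h ⟩ ⟨ pair x y , s , 0 , 0 , g , h ⟩
    join-exec = exchange-AS ∙ push-exec ∙ exchange-AS

    copy-exec : ∀ {a s} → Exec X copy ⟨ a , s , 0 , 0 , g , h ⟩ ⟨ a , s , a , 0 , g , h ⟩
    copy-exec {a} {s} =
        rewriteʳ (cong₂ (λ m n → ⟨ 0 , s , m , n , g , h ⟩) (+-identityʳ a) (+-identityʳ a))
          (transfer₂-exec (λ x y z → ⟨ x , s , y , z , g , h ⟩) (λ _ _ _ → refl) (λ _ _ _ → refl) a 0 0)
      ∙ transfer-exec₀ (λ x y → ⟨ y , s , a , x , g , h ⟩) (λ _ _ → refl) (λ _ _ → refl) a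

    clear-A : ∀ {a s d t} → Exec X (clear Acc) ⟨ a , s , d , t , g , h ⟩ ⟨ 0 , s , d , t , g , h ⟩
    clear-A {a} {s} {d} {t} = clear-exec (λ x → ⟨ x , s , d , t , g , h ⟩) (λ _ → refl) (λ _ → refl) a

    clear-D : ∀ {a s d t} → Exec X (clear Dat) ⟨ a , s , d , t , g , h ⟩ ⟨ a , s , 0 , t , g , h ⟩
    clear-D {a} {s} {d} {t} = clear-exec (λ x → ⟨ a , s , x , t , g , h ⟩) (λ _ → refl) (λ _ → refl) d

    transfer-DA : ∀ {s d t} → Exec X (transfer Dat Acc) ⟨ 0 , s , d , t , g , h ⟩ ⟨ d , s , 0 , t , g , h ⟩
    transfer-DA {s} {d} {t} = transfer-exec₀ (λ x y → ⟨ y , s , x , t , g , h ⟩) (λ _ _ → refl) (λ _ _ → refl) d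

-- A combinator language and its compiler

-- Total functions on hereditary pairs of numbers.  The compiled code keeps its
-- argument in Acc and saves intermediate results on a stack coded in Stk.

infixr 6 _⊗_

data Ty : Set where
  N   : Ty
  _⊗_ : Ty → Ty → Ty

⟦_⟧ : Ty → Set
⟦ N ⟧     = ℕ
⟦ A ⊗ B ⟧ = ⟦ A ⟧ × ⟦ B ⟧

encode : ∀ A → ⟦ A ⟧ → ℕ
encode N n             = n
encode (A ⊗ B) (a , b) = pair (encode A a) (encode B b)

parse : ∀ A → ℕ → ⟦ A ⟧
parse N n       = n
parse (A ⊗ B) n = parse A (proj₁ (unpair n)) , parse B (proj₂ (unpair n))

-- Pairing is a bijection, so every number is a code at every type. This lets `unpack` compile to
-- `skip`.
encode-parse : ∀ A n → encode A (parse A n) ≡ n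
encode-parse N n = refl
encode-parse (A ⊗ B) n = trans (cong₂ pair (encode-parse A _) (encode-parse B _)) (pair-unpair n)

parse-encode : ∀ A a → parse A (encode A a) ≡ a
parse-encode N n = refl
parse-encode (A ⊗ B) (a , b) rewrite unpair-pair (encode A a) (encode B b) =
  cong₂ _,_ (parse-encode A a) (parse-encode B b)

ifzero : {A : Set} → ℕ → A → A → A
ifzero zero    a b = a
ifzero (suc _) a b = b

iterate : {A : Set} → (A → A) → ℕ → A → A
iterate f zero    a = a
iterate f (suc n) a = iterate f n (f a)

infixr 9 _⊙_

data Tm : Ty → Ty → Set where
  id       : ∀ {A} → Tm A A
  _⊙_      : ∀ {A B C} → Tm B C → Tm A B → Tm A C
  ⟪_,_⟫    : ∀ {A B C} → Tm A B → Tm A C → Tm A (B ⊗ C)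
  fst      : ∀ {A B} → Tm (A ⊗ B) A
  snd      : ∀ {A B} → Tm (A ⊗ B) B
  zero     : ∀ {A} → Tm A N
  suc pred′ : Tm N N
  ifz      : ∀ {A B} → Tm A N → Tm A B → Tm A B → Tm A B
  iter     : ∀ {A} → Tm A A → Tm (N ⊗ A) A
  pack     : ∀ {A} → Tm A N
  unpack   : ∀ {A} → Tm N A

eval : ∀ {A B} → Tm A B → ⟦ A ⟧ → ⟦ B ⟧
eval id a              = a
eval (f ⊙ g) a         = eval f (eval g a)
eval ⟪ f , g ⟫ a       = eval f a , eval g a
eval fst a             = proj₁ a
eval snd a             = proj₂ a
eval zero _            = 0
eval suc n             = suc n
eval pred′ n           = pred n
eval (ifz c f g) a     = ifzero (eval c a) (eval f a) (eval g a)
eval (iter f) a        = iterate (eval f) (proj₁ a) (proj₂ a)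
eval (pack {A}) a      = encode A a
eval (unpack {A}) n    = parse A n

compile : ∀ {A B} → Tm A B → Cmd
compile id          = skip
compile (f ⊙ g)     = compile g ∙ compile f
-- The argument lies on the stack while f runs, and the result of f while g runs.
compile ⟪ f , g ⟫   = copy ∙ push ∙ compile f ∙ pop ∙ exchange Acc Dat ∙ push
                    ∙ compile g ∙ pop ∙ join
compile fst         = split ∙ clear Acc ∙ transfer Dat Acc
compile snd         = split ∙ clear Dat
compile zero        = clear Acc
compile suc         = inc Acc
compile pred′       = dec Acc
compile (ifz c f g) = copy ∙ push ∙ compile c ∙ pop ∙ exchange Acc Dat
                    ∙ ifz Dat (compile f) (clear Dat ∙ compile g)
compile (iter f)    = split ∙ while Dat (dec Dat ∙ push ∙ compile f ∙ pop)
compile pack        = skip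
compile unpack      = skip

-- The stack s is arbitrary and left intact, since subterms run on top of saved values.
compile-exec : ∀ {X g h A B} (f : Tm A B) a {s} →
  Exec X (compile f) ⟨ encode A a , s , 0 , 0 , g , h ⟩ ⟨ encode B (eval f a) , s , 0 , 0 , g , h ⟩
compile-exec id a = skip
compile-exec (f ⊙ g) a = compile-exec g a ∙ compile-exec f (eval g a)
compile-exec (⟪_,_⟫ {B = B} f g) a = copy-exec ∙ push-exec ∙ compile-exec f a ∙ pop-pair ∙ exchange-AD
  ∙ push-exec {d = encode B (eval f a)}
  ∙ compile-exec g a ∙ pop-pair ∙ join-exec {x = encode B (eval f a)}
compile-exec (fst {A} {B}) (a , b) = split-pair {x = encode A a} {encode B b} ∙ clear-A ∙ transfer-DA
compile-exec (snd {A} {B}) (a , b) = split-pair {x = encode A a} {encode B b} ∙ clear-D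
compile-exec zero a = clear-A
compile-exec suc n = inc
compile-exec pred′ n = dec
compile-exec {X} (ifz {A} c f g) a {s} = copy-exec ∙ push-exec ∙ compile-exec c a ∙ pop-pair ∙ exchange-AD ∙ branch (eval c a)
  where
  branch : ∀ n → Exec X (ifz Dat (compile f) (clear Dat ∙ compile g)) ⟨ encode A a , s , n , 0 , _ , _ ⟩
    ⟨ encode _ (ifzero n (eval f a) (eval g a)) , s , 0 , 0 , _ , _ ⟩
  branch zero    = ifz0 refl (compile-exec f a)
  branch (suc n) = ifz+ refl (clear-D ∙ compile-exec g a)
compile-exec {X} (iter {A} f) (n , a) {s} = split-pair ∙ loop n a
  where
  loop : ∀ n a → Exec X (while Dat (dec Dat ∙ push ∙ compile f ∙ pop)) ⟨ encode A a , s , n , 0 , _ , _ ⟩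
    ⟨ encode A (iterate (eval f) n a) , s , 0 , 0 , _ , _ ⟩
  loop zero a    = while0 refl
  loop (suc n) a = while+ refl (dec ∙ push-exec ∙ compile-exec f a ∙ pop-pair) (loop n (eval f a))
compile-exec pack a = skip
compile-exec (unpack {A}) n {s} = rewriteʳ (cong (λ m → ⟨ m , s , 0 , 0 , _ , _ ⟩) (sym (encode-parse A n))) skip

-- Machines that iterate a total function

-- A transition yields (t , x , y , z): halt with output x if t = 0, consult
-- the oracle at x if t = 1, ask the query (x , y) otherwise.  The next state
-- is z together with the answer, 1 standing for ↓ and 0 for ↑.
State : Ty → Ty
State Z = N ⊗ Z

Request : Ty → Ty
Request Z = N ⊗ N ⊗ N ⊗ Z

bit : Bool → ℕ
bit b = if b then 1 else 0

dispatch : ∀ {Z : Set} → Oracle → ℕ × ℕ × ℕ × Z → Move (ℕ × Z)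
dispatch X (0           , x , y , z) = stop x
dispatch X (1           , x , y , z) = go (bit (X x) , z)
dispatch X (suc (suc _) , x , y , z) = ask x y (1 , z) (0 , z)

system : ∀ {Z} → Tm (State Z) (Request Z) → Oracle → System ⟦ State Z ⟧
system δ X s = dispatch X (eval δ s)

registers : ∀ {Z} → ⟦ Request Z ⟧ → Regs
registers {Z} (t , x , y , z) = ⟨ encode Z z , 0 , y , 0 , t , x ⟩

strokes-replicate : ∀ n → strokes (replicate n stroke) ≡ n
strokes-replicate zero    = refl
strokes-replicate (suc n) = cong suc (strokes-replicate n)

initial-holds : ∀ n → Holds (initial n) 0 ⟨ n , 0 , 0 , 0 , 0 , 0 ⟩
initial-holds n = holds refl vals
  where
  vals : ∀ i → value (input n (toℕ i)) ≡ lookup ⟨ n , 0 , 0 , 0 , 0 , 0 ⟩ i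
  vals zero = value-replicate n
    where
    value-replicate : ∀ n → value (startingWith (replicate n stroke)) ≡ n
    value-replicate zero    = refl
    value-replicate (suc n) = cong suc (strokes-replicate n)
  vals Stk = refl
  vals Dat = refl
  vals Tmp = refl
  vals Tag = refl
  vals Arg = refl

module Loop (prologue restart finish : Cmd) where

  answer body main : Cmd
  -- Tag has just been decremented, so zero now stands for the tag 1. Tmp is zero beforehand and
  -- receives the answer.
  answer  = ifz Tag (consult Arg Tmp) (query Arg Dat Tmp)
  body    = dec Tag ∙ answer ∙ restart
  main    = prologue ∙ while Tag body ∙ finish

  looping : Program
  looping = assemble 0 main

  module _ {Z : Ty} (X : Oracle) (δ : Tm (State Z) (Request Z))
    (restart-exec : ∀ b z y t x → Exec X restart ⟨ encode Z z , 0 , y , b , t , x ⟩ (registers (eval δ (b , z))))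
    (finish-exec : ∀ z y x → Exec X finish ⟨ encode Z z , 0 , y , 0 , 0 , x ⟩ ⟨ x , 0 , y , 0 , 0 , 0 ⟩)
    where
    open Execution looping X
    open Holds

    -- The positions of the loop test, of `answer`, of `restart` and of `finish`; 8 is the size of
    -- `answer`.
    p₁ p₂ p₃ p₄ : ℕ
    p₁ = size prologue + 0
    p₂ = 2 + p₁
    p₃ = 8 + p₂
    p₄ = 2 + size body + p₁

    at-main : looping contains main at 0
    at-main = contains (drop⇒at 0 looping refl)

    at₁ = at-∙ at-main
    at₂ = at-∙ (proj₂ at₁)
    at-loop = at-while (proj₁ at₂)
    at-body = at-∙ (proj₁ (proj₂ at-loop))
    at-answer = at-∙ (proj₂ at-body)
    at-branch = at-ifz (proj₁ at-answer)

    -- At the loop test δ has already been applied: the registers hold the request made in state s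
    -- rather than s itself.
    Represents : Config → ⟦ State Z ⟧ → Set
    Represents c s = Holds c p₁ (registers (eval δ s))

    open Implementation (machine looping X) (system δ X) Represents

    resume : ∀ {c} b z y t x → Holds c p₃ ⟨ encode Z z , 0 , y , b , t , x ⟩ → Reaches c (b , z)
    resume {c} b z y t x h = run {c = c} (restart-exec b z y t x) (proj₂ at-answer) h
      then λ {c′} h → leads {c′} (run-jump (trans (cong (fetch looping) place) (proj₂ (proj₂ at-loop))) h)
      where
      place : size restart + p₃ ≡ size body + (1 + p₁)
      place = trans (sym (+-assoc (size restart) 8 p₂)) (sym (+-assoc (size restart + 8) 1 (1 + p₁)))

    at-end : fetch looping (size finish + p₄) ≡ halt
    at-end = trans (cong (fetch looping) (trans place (sym (length-assemble 0 main)))) (fetch-end looping)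
      where
      place : size finish + p₄ ≡ size main
      place = trans (sym (+-assoc (size finish) (2 + size body) p₁))
        (cong (size finish + (2 + size body) +_) (+-identityʳ (size prologue)))

    match : ∀ {c s} → Represents c s → Matches c (system δ X s)
    match {c} {s} h = by (eval δ s) h
      where
      by : ∀ q → Holds c p₁ (registers q) → Matches c (dispatch X q)
      by (zero , x , y , z) h = halting (leads {c} (run-test-zero Tag (proj₁ at-loop) refl h)
          then run (finish-exec z y x) (proj₂ at₂))
        where
        halting : Leads c (size finish + p₄) ⟨ x , 0 , y , 0 , 0 , 0 ⟩ → Matches c (stop x)
        halting (c′ , s , holds refl val) = c′ , s ,
          trans (cong (λ i → embed (output c′) (execute X i (Config.tapes c′))) at-end) (cong stop (val zero))
      by (suc zero , x , y , z) h with run-test-suc Tag (proj₁ at-loop) refl h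
      ... | c₁ , eq , l = c₁ , eq , (l then run dec (proj₁ at-body) then consulted (X x) refl)
        where
        consulted : ∀ {c} b → X x ≡ b → Holds c p₂ ⟨ encode Z z , 0 , y , 0 , 0 , x ⟩ → Reaches c (bit b , z)
        consulted {c} false eq h = run {c = c} (ifz0 refl (consult0 eq)) (proj₁ at-answer) h then resume 0 z y 0 x
        consulted {c} true eq h = run {c = c} (ifz0 refl (consult1 eq)) (proj₁ at-answer) h then resume 1 z y 0 x
      by (suc (suc t) , x , y , z) h = asking (leads {c} (run-test-suc Tag (proj₁ at-loop) refl h)
          then run dec (proj₁ at-body) then λ {c} h → leads {c} (run-test-suc Tag (proj₁ at-branch) refl h))
        where
        at-query : looping contains query Arg Dat Tmp at (5 + p₂)
        at-query = proj₂ (proj₂ (proj₂ at-branch))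
        asking : Leads c (5 + p₂) ⟨ encode Z z , 0 , y , 0 , suc t , x ⟩ → Matches c (ask x y (1 , z) (0 , z))
        asking (c′ , s , holds refl val) = c′ , _ , _ , s , asks , continued , resume 0 z y (suc t) x (holds refl val)
          where
          asks : σ c′ ≡ ask x y (config (6 + p₂) (Config.tapes c′)) (config (8 + p₂) (Config.tapes c′))
          asks = trans (cong (λ i → embed (output c′) (execute X i (Config.tapes c′))) (proj₁ (instructions at-query)))
            (cong₂ (λ x y → ask x y _ _) (val Arg) (val Dat))
          continued : Reaches (config (6 + p₂) (Config.tapes c′)) (1 , z)
          continued = leads {config (6 + p₂) (Config.tapes c′)} (run-inc {v = ⟨ encode Z z , 0 , y , 0 , suc t , x ⟩} Tmp (proj₂ (instructions at-query)) (holds refl val))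
            then resume 1 z y (suc t) x

    module _ {C : Graph} {e : ℕ} (e-looping : program e ≡ looping) (begin : ℕ → ⟦ State Z ⟧)
      (prologue-exec : ∀ n → Exec X prologue ⟨ n , 0 , 0 , 0 , 0 , 0 ⟩ (registers (eval δ (begin n)))) where

      start : ∀ n → Reaches (initial n) (begin n)
      start n = run {c = initial n} (prologue-exec n) (proj₁ at₁) (initial-holds n)

      loop-I⇒behaviour : ∀ {m r} → I X C e m r → Behaviour C (system δ X) (begin m) r
      loop-I⇒behaviour {m} i = abstraction match (start m)
        (subst (λ P → Behaviour C (machine P X) (initial m) _) e-looping (I⇒behaviour {e = e} i))

      loop-behaviour⇒I : ∀ {m r} → Behaviour C (system δ X) (begin m) r → I X C e m r
      loop-behaviour⇒I {m} b = behaviour⇒I {e = e} (subst (λ P → Behaviour C (machine P X) (initial m) _) (sym e-looping)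
        (implement match (start m) b))

module Driver {Z : Ty} (init : Tm N (State Z)) (δ : Tm (State Z) (Request Z)) where

  prepare restart finish prologue : Cmd
  prepare  = compile δ ∙ split ∙ transfer Dat Tag ∙ split ∙ transfer Dat Arg ∙ split
  restart  = clear Dat ∙ transfer Tmp Dat ∙ clear Tag ∙ clear Arg ∙ join ∙ prepare
  finish   = clear Acc ∙ transfer Arg Acc
  prologue = compile init ∙ prepare

  open Loop prologue restart finish using (looping; loop-I⇒behaviour; loop-behaviour⇒I)

  driver : Program
  driver = looping

  module _ {X : Oracle} where

    prepare-exec : ∀ s → Exec X prepare ⟨ encode (State Z) s , 0 , 0 , 0 , 0 , 0 ⟩ (registers (eval δ s))
    prepare-exec s with eval δ s | compile-exec {X} {0} {0} δ s {0}
    ... | t , x , y , z | e = e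
      ∙ split-pair {x = t} {encode (N ⊗ N ⊗ Z) (x , y , z)}
      ∙ transfer-exec₀ (λ i j → ⟨ encode (N ⊗ N ⊗ Z) (x , y , z) , 0 , i , 0 , j , 0 ⟩) (λ _ _ → refl) (λ _ _ → refl) t
      ∙ split-pair {x = x} {encode (N ⊗ Z) (y , z)}
      ∙ transfer-exec₀ (λ i j → ⟨ encode (N ⊗ Z) (y , z) , 0 , i , 0 , t , j ⟩) (λ _ _ → refl) (λ _ _ → refl) x
      ∙ split-pair {x = y} {encode Z z}

    restart-exec : ∀ b z y t x → Exec X restart ⟨ encode Z z , 0 , y , b , t , x ⟩ (registers (eval δ (b , z)))
    restart-exec b z y t x =
        clear-D
      ∙ transfer-exec₀ (λ i j → ⟨ encode Z z , 0 , j , i , t , x ⟩) (λ _ _ → refl) (λ _ _ → refl) b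
      ∙ clear-exec (λ i → ⟨ encode Z z , 0 , b , 0 , i , x ⟩) (λ _ → refl) (λ _ → refl) t
      ∙ clear-exec (λ i → ⟨ encode Z z , 0 , b , 0 , 0 , i ⟩) (λ _ → refl) (λ _ → refl) x
      ∙ join-exec {x = b} {encode Z z}
      ∙ prepare-exec (b , z)

    finish-exec : ∀ z y x → Exec X finish ⟨ encode Z z , 0 , y , 0 , 0 , x ⟩ ⟨ x , 0 , y , 0 , 0 , 0 ⟩
    finish-exec z y x = clear-A
      ∙ transfer-exec₀ (λ i j → ⟨ j , 0 , y , 0 , 0 , i ⟩) (λ _ _ → refl) (λ _ _ → refl) x

    prologue-exec : ∀ n → Exec X prologue ⟨ n , 0 , 0 , 0 , 0 , 0 ⟩ (registers (eval δ (eval init n)))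
    prologue-exec n = compile-exec init n ∙ prepare-exec (eval init n)

    module _ {C : Graph} {e : ℕ} (e-driver : program e ≡ driver) where

      driver-I⇒behaviour : ∀ {m r} → I X C e m r → Behaviour C (system δ X) (eval init m) r
      driver-I⇒behaviour = loop-I⇒behaviour X δ restart-exec finish-exec e-driver (eval init) prologue-exec

      driver-behaviour⇒I : ∀ {m r} → Behaviour C (system δ X) (eval init m) r → I X C e m r
      driver-behaviour⇒I = loop-behaviour⇒I X δ restart-exec finish-exec e-driver (eval init) prologue-exec

-- A universal program on numerical codes

hd tl : ℕ → ℕ
hd n = proj₁ (unpair (pred n))
tl n = proj₂ (unpair (pred n))

cons : ℕ → ℕ → ℕ
cons x n = suc (pair x n)

hd-cons : ∀ x n → hd (cons x n) ≡ x
hd-cons x n = cong proj₁ (unpair-pair x n)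

tl-cons : ∀ x n → tl (cons x n) ≡ n
tl-cons x n = cong proj₂ (unpair-pair x n)

iterate-suc : ∀ {A : Set} (f : A → A) n a → iterate f (suc n) a ≡ f (iterate f n a)
iterate-suc f zero    a = refl
iterate-suc f (suc n) a = iterate-suc f n (f a)

nth : ℕ → ℕ → ℕ
nth i n = hd (iterate tl i n)

nth-zero : ∀ i → nth i 0 ≡ 0
nth-zero zero    = refl
nth-zero (suc i) = nth-zero i

n≤triangle : ∀ n → n ≤ triangle n
n≤triangle zero    = z≤n
n≤triangle (suc n) = m≤m+n (suc n) (triangle n)

y≤pair : ∀ x y → y ≤ pair x y
y≤pair x y = ≤-trans (m≤n+m y x) (≤-trans (n≤triangle (x + y)) (m≤m+n _ x))

-- Decoding loses nothing since tl n < n for n > 0.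
fetch-nth : ∀ e q → fetch (program e) q ≡ toInstruction (nth q e)
fetch-nth e q = from q e e ≤-refl
  where
  tail≤ : ∀ n → proj₂ (unpair n) ≤ n
  tail≤ n = subst (proj₂ (unpair n) ≤_) (pair-unpair n) (y≤pair (proj₁ (unpair n)) (proj₂ (unpair n)))
  empty : ∀ q b → fetch (map toInstruction (decodeWithin b 0)) q ≡ halt
  empty zero    zero    = refl
  empty zero    (suc b) = refl
  empty (suc q) zero    = refl
  empty (suc q) (suc b) = refl
  from : ∀ q b n → n ≤ b → fetch (map toInstruction (decodeWithin b n)) q ≡ toInstruction (nth q n)
  from q b zero _ = trans (empty q b) (sym (cong toInstruction (nth-zero q)))
  from zero    (suc b) (suc n) (s≤s le) = refl
  from (suc q) (suc b) (suc n) (s≤s le) = from q b _ (≤-trans (tail≤ n) le)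

-- Replacing an entry of a list, with a stack of the entries before it.

descend ascend : ℕ × ℕ → ℕ × ℕ
descend (r , l) = cons (hd l) r , tl l
ascend (r , l)  = tl r , cons (hd r) l

put : ℕ → ℕ → ℕ → ℕ
put t x l = let z = iterate descend t (0 , l) in
  proj₂ (iterate ascend t (proj₁ z , cons x (tl (proj₂ z))))

private
  -- The update by structural recursion, against which `put` is verified; `Tm` offers only
  -- iteration, hence the detour through a stack in `put`.
  putᵣ : ℕ → ℕ → ℕ → ℕ
  putᵣ zero    x l = cons x (tl l)
  putᵣ (suc t) x l = cons (hd l) (putᵣ t x (tl l))

  put-putᵣ : ∀ t x r l → let z = iterate descend t (r , l) in
    iterate ascend t (proj₁ z , cons x (tl (proj₂ z))) ≡ (r , putᵣ t x l)
  put-putᵣ zero x r l = refl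
  put-putᵣ (suc t) x r l = trans (iterate-suc ascend t _)
    (trans (cong ascend (put-putᵣ t x (cons (hd l) r) (tl l)))
      (cong₂ (λ i j → i , cons j (putᵣ t x (tl l))) (tl-cons (hd l) r) (hd-cons (hd l) r)))

  nth-putᵣ : ∀ u t x l → nth u (putᵣ t x l) ≡ (if does (u ≟ t) then x else nth u l)
  nth-putᵣ zero    zero    x l = hd-cons x _
  nth-putᵣ zero    (suc t) x l = hd-cons (hd l) _
  nth-putᵣ (suc u) zero    x l = cong (nth u) (tl-cons x (tl l))
  nth-putᵣ (suc u) (suc t) x l = trans (cong (nth u) (tl-cons (hd l) _)) (nth-putᵣ u t x (tl l))

nth-put : ∀ u t x l → nth u (put t x l) ≡ (if does (u ≟ t) then x else nth u l)
nth-put u t x l = trans (cong (λ z → nth u (proj₂ z)) (put-putᵣ t x 0 l)) (nth-putᵣ u t x l)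

-- Codes of tapes; the tail and the head of 0 being 0, blanks need not be stored.

data _≋_ : List Symbol → ℕ → Set where
  []  : [] ≋ 0
  _∷_ : ∀ {s w l n} → s ≡ toSymbol w → l ≋ n → (s ∷ l) ≋ cons w n

scan : ℕ × ℕ → ℕ × ℕ
scan (k , l) = ifzero (hd l) (k , l) (suc k , tl l)

-- The code of a list bounds its length, so l rounds suffice; from the first blank on `scan` changes
-- nothing.
count : ℕ → ℕ
count l = proj₁ (iterate scan l (0 , l))

count-strokes : ∀ {l n} → l ≋ n → count n ≡ strokes l
count-strokes {l} {n} l≋n = trans (counts l≋n n (bounded l≋n) 0) refl
  where
  bounded : ∀ {l n} → l ≋ n → length l ≤ n
  bounded [] = z≤n
  bounded (_∷_ {w = w} _ r) = s≤s (≤-trans (bounded r) (y≤pair w _))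
  stuck : ∀ k c n → hd n ≡ 0 → proj₁ (iterate scan k (c , n)) ≡ c
  stuck zero    c n eq = refl
  stuck (suc k) c n eq rewrite eq = stuck k c n eq
  counts : ∀ {l n} → l ≋ n → ∀ k → length l ≤ k → ∀ c → proj₁ (iterate scan k (c , n)) ≡ c + strokes l
  counts [] k _ c = trans (stuck k c 0 refl) (sym (+-identityʳ c))
  counts (_∷_ {w = zero} {n = n} refl r) k le c = trans (stuck k c (cons 0 n) (hd-cons 0 n)) (sym (+-identityʳ c))
  counts (_∷_ {w = suc w} {l} {n = n} refl r) (suc k) (s≤s le) c =
    trans (cong (λ z → proj₁ (iterate scan k z)) step-eq)
      (trans (counts r k le (suc c)) (sym (+-suc c (strokes l))))
    where
    step-eq : scan (c , cons (suc w) n) ≡ (suc c , n)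
    step-eq = trans (cong (λ i → ifzero i (c , cons (suc w) n) (suc c , tl (cons (suc w) n))) (hd-cons (suc w) n))
      (cong (suc c ,_) (tl-cons (suc w) n))

TapeCode : Set
TapeCode = ℕ × ℕ × ℕ

record _≈_ (τ : Tape) (n : TapeCode) : Set where
  constructor similar
  field
    ≈before  : Tape.before τ ≋ proj₁ n
    ≈scanned : Tape.scanned τ ≡ toSymbol (proj₁ (proj₂ n))
    ≈after   : Tape.after τ ≋ proj₂ (proj₂ n)
open _≈_

moveLeft moveRight : TapeCode → TapeCode
moveLeft  (b , s , a) = tl b , hd b , cons s a
moveRight (b , s , a) = cons s b , hd a , tl a

≈left : ∀ {τ n} → τ ≈ n → shift left τ ≈ moveLeft n
≈left (similar [] s a) = similar [] refl (s ∷ a)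
≈left (similar (_∷_ {w = w} {n = n} e b) s a) = similar (subst (_ ≋_) (sym (tl-cons w n)) b)
  (trans e (cong toSymbol (sym (hd-cons w n)))) (s ∷ a)

≈right : ∀ {τ n} → τ ≈ n → shift right τ ≈ moveRight n
≈right (similar b s []) = similar (s ∷ b) refl []
≈right (similar b s (_∷_ {w = w} {n = n} e a)) = similar (s ∷ b)
  (trans e (cong toSymbol (sym (hd-cons w n)))) (subst (_ ≋_) (sym (tl-cons w n)) a)

moveCode : ℕ → TapeCode → TapeCode
moveCode d n = ifzero d (moveLeft n) (ifzero (pred d) (moveRight n) n)

≈shift : ∀ d {τ n} → τ ≈ n → shift (toDirection d) τ ≈ moveCode d n
≈shift 0 r = ≈left r
≈shift 1 r = ≈right r
≈shift (suc (suc d)) r = r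

valueCode : TapeCode → ℕ
valueCode (b , s , a) = count (cons s a)

≈value : ∀ {τ n} → τ ≈ n → valueCode n ≡ value τ
≈value r = count-strokes (≈scanned r ∷ ≈after r)

tapeAt : ℕ → ℕ → TapeCode
tapeAt t l = parse (N ⊗ N ⊗ N) (nth t l)

_≈*_ : (ℕ → Tape) → ℕ → Set
τs ≈* l = ∀ t → τs t ≈ tapeAt t l

≈put : ∀ {τs l τ n} t → τs ≈* l → τ ≈ n → (τs [ t ]≔ τ) ≈* put t (encode (N ⊗ N ⊗ N) n) l
≈put {τs} {l} {τ} {n} t rs r u = subst (λ m → _ ≈ parse (N ⊗ N ⊗ N) m) (sym (nth-put u t (encode (N ⊗ N ⊗ N) n) l)) (by (does (u ≟ t)))
  where
  by : ∀ b → (if b then τ else τs u) ≈ parse (N ⊗ N ⊗ N) (if b then encode (N ⊗ N ⊗ N) n else nth u l)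
  by true  = subst (_ ≈_) (sym (parse-encode (N ⊗ N ⊗ N) n)) r
  by false = rs u

one two : ∀ {A} → Tm A N
one = suc ⊙ zero
two = suc ⊙ one

hdₜ tlₜ : Tm N N
hdₜ = fst ⊙ unpack {N ⊗ N} ⊙ pred′
tlₜ = snd ⊙ unpack {N ⊗ N} ⊙ pred′

consₜ nthₜ : Tm (N ⊗ N) N
consₜ = suc ⊙ pack
nthₜ  = hdₜ ⊙ iter tlₜ

putₜ : Tm (N ⊗ N ⊗ N) N
putₜ = snd ⊙ iter up ⊙ ⟪ fst , ⟪ fst ⊙ z , consₜ ⊙ ⟪ fst ⊙ snd , tlₜ ⊙ snd ⊙ z ⟫ ⟫ ⟫
  where
  down up : Tm (N ⊗ N) (N ⊗ N)
  down = ⟪ consₜ ⊙ ⟪ hdₜ ⊙ snd , fst ⟫ , tlₜ ⊙ snd ⟫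
  up   = ⟪ tlₜ ⊙ fst , consₜ ⊙ ⟪ hdₜ ⊙ fst , snd ⟫ ⟫
  z : Tm (N ⊗ N ⊗ N) (N ⊗ N)
  z = iter down ⊙ ⟪ fst , ⟪ zero , snd ⊙ snd ⟫ ⟫

countₜ : Tm N N
countₜ = fst ⊙ iter (ifz (hdₜ ⊙ snd) id ⟪ suc ⊙ fst , tlₜ ⊙ snd ⟫) ⊙ ⟪ id , ⟪ zero , id ⟫ ⟫

valueₜ : Tm (N ⊗ N ⊗ N) N
valueₜ = countₜ ⊙ consₜ ⊙ snd

tapeAtₜ : Tm (N ⊗ N) (N ⊗ N ⊗ N)
tapeAtₜ = unpack ⊙ nthₜ

moveₜ : Tm (N ⊗ N ⊗ N ⊗ N) (N ⊗ N ⊗ N)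
moveₜ = ifz fst (leftₜ ⊙ snd) (ifz (pred′ ⊙ fst) (rightₜ ⊙ snd) snd)
  where
  leftₜ rightₜ : Tm (N ⊗ N ⊗ N) (N ⊗ N ⊗ N)
  leftₜ  = ⟪ tlₜ ⊙ fst , ⟪ hdₜ ⊙ fst , consₜ ⊙ snd ⟫ ⟫
  rightₜ = ⟪ consₜ ⊙ ⟪ fst ⊙ snd , fst ⟫ , ⟪ hdₜ ⊙ snd ⊙ snd , tlₜ ⊙ snd ⊙ snd ⟫ ⟫

-- (e , (q₁ , q₀) , l): program e on the tapes l, about to continue in state
-- q₁ or q₀ according to the last answer.
Simulation : Ty
Simulation = N ⊗ (N ⊗ N) ⊗ N

Pending : Ty → Ty
Pending A = A ⊗ N ⊗ N

module _ {A : Ty} where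
  programₜ tapesₜ : Tm (Pending A) N
  programₜ = fst ⊙ snd
  tapesₜ   = snd ⊙ snd

  valueAtₜ : Tm (Pending A) N → Tm (Pending A) N
  valueAtₜ t = valueₜ ⊙ tapeAtₜ ⊙ ⟪ t , tapesₜ ⟫

  requestₜ : (t x y q₁ q₀ : Tm (Pending A) N) → Tm (Pending A) N → Tm (Pending A) (Request Simulation)
  requestₜ t x y q₁ q₀ l = ⟪ t , ⟪ x , ⟪ y , ⟪ programₜ , ⟪ ⟪ q₁ , q₀ ⟫ , l ⟫ ⟫ ⟫ ⟫ ⟫

haltₜ : Tm (Pending N) (Request Simulation)
haltₜ = requestₜ zero (valueAtₜ zero) zero zero zero tapesₜ

-- No request is a plain step. Consulting X(0) and going on to the same state after either answer
-- serves instead; the selection program uses the same device.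
actₜ : Tm (Pending (N ⊗ N ⊗ N)) (Request Simulation)
actₜ = requestₜ one zero zero (snd ⊙ snd ⊙ actionₜ) (snd ⊙ snd ⊙ actionₜ) (putₜ ⊙ ⟪ fst ⊙ fst , ⟪ pack ⊙ movedₜ , tapesₜ ⟫ ⟫)
  where
  scannedₜ actionₜ movedₜ : Tm (Pending (N ⊗ N ⊗ N)) (N ⊗ N ⊗ N)
  scannedₜ = tapeAtₜ ⊙ ⟪ fst ⊙ fst , tapesₜ ⟫
  actionₜ  = unpack ⊙ ifz (fst ⊙ snd ⊙ scannedₜ) (fst ⊙ snd ⊙ fst) (snd ⊙ snd ⊙ fst)
  movedₜ   = moveₜ ⊙ ⟪ fst ⊙ snd ⊙ actionₜ , ⟪ fst ⊙ scannedₜ , ⟪ fst ⊙ actionₜ , snd ⊙ snd ⊙ scannedₜ ⟫ ⟫ ⟫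

oracleₜ : Tm (Pending (N ⊗ N ⊗ N)) (Request Simulation)
oracleₜ = requestₜ one (valueAtₜ (fst ⊙ fst)) zero (snd ⊙ snd ⊙ fst) (fst ⊙ snd ⊙ fst) tapesₜ

queryₜ : Tm (Pending ((N ⊗ N) ⊗ N ⊗ N)) (Request Simulation)
queryₜ = requestₜ two (valueAtₜ (fst ⊙ fst ⊙ fst)) (valueAtₜ (snd ⊙ fst ⊙ fst)) (fst ⊙ snd ⊙ fst) (snd ⊙ snd ⊙ fst) tapesₜ

withTagₜ : Tm (Pending (N ⊗ N)) (Request Simulation)
withTagₜ = ifz tagₜ (haltₜ ⊙ as) (ifz (pred′ ⊙ tagₜ) (actₜ ⊙ as) (ifz (pred′ ⊙ pred′ ⊙ tagₜ) (oracleₜ ⊙ as) (queryₜ ⊙ as)))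
  where
  tagₜ : Tm (Pending (N ⊗ N)) N
  tagₜ = fst ⊙ fst
  as : ∀ {A} → Tm (Pending (N ⊗ N)) (Pending A)
  as = ⟪ unpack ⊙ snd ⊙ fst , snd ⟫

opaque
  universal : Tm (State Simulation) (Request Simulation)
  universal = withTagₜ ⊙ ⟪ unpack ⊙ nthₜ ⊙ ⟪ ifz fst (snd ⊙ states) (fst ⊙ states) , fst ⊙ snd ⟫ , ⟪ fst ⊙ snd , snd ⊙ snd ⊙ snd ⟫ ⟫
    where
    states : Tm (State Simulation) (N ⊗ N)
    states = fst ⊙ snd ⊙ snd

beginₜ : Tm (N ⊗ N) Simulation
beginₜ = ⟪ fst , ⟪ ⟪ zero , zero ⟫ , consₜ ⊙ ⟪ pack ⊙ ⟪ zero , ⟪ hdₜ ⊙ inputₜ , tlₜ ⊙ inputₜ ⟫ ⟫ , zero ⟫ ⟫ ⟫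
  where
  inputₜ : Tm (N ⊗ N) N
  inputₜ = iter (consₜ ⊙ ⟪ one , id ⟫) ⊙ ⟪ snd , zero ⟫

begin : ℕ × ℕ → ⟦ State Simulation ⟧
begin em = 0 , eval beginₜ em

≋-replicate : ∀ m → replicate m stroke ≋ iterate (cons 1) m 0
≋-replicate zero    = []
≋-replicate (suc m) = subst (replicate (suc m) stroke ≋_) (sym (iterate-suc (cons 1) m 0)) (_∷_ {w = 1} refl (≋-replicate m))

≈startingWith : ∀ {l n} → l ≋ n → startingWith l ≈ (0 , hd n , tl n)
≈startingWith [] = similar [] refl []
≈startingWith (_∷_ {w = w} {n = n} e r) = similar [] (trans e (cong toSymbol (sym (hd-cons w n))))
  (subst (_ ≋_) (sym (tl-cons w n)) r)

module _ (e : ℕ) where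

  data Simulated : Config → ⟦ State Simulation ⟧ → Set where
    simulated : ∀ {q τs b q₁ q₀ l} → q ≡ ifzero b q₀ q₁ → τs ≈* l → Simulated (config q τs) (b , e , (q₁ , q₀) , l)

  simulated-begin : ∀ m → Simulated (initial m) (begin (e , m))
  simulated-begin m = simulated refl λ where
      zero    → subst (startingWith (replicate m stroke) ≈_)
        (sym (trans (cong (parse (N ⊗ N ⊗ N)) (hd-cons (encode (N ⊗ N ⊗ N) first) 0)) (parse-encode (N ⊗ N ⊗ N) first)))
        (≈startingWith (≋-replicate m))
      (suc t) → subst (λ n → tape [] blank [] ≈ parse (N ⊗ N ⊗ N) n)
        (sym (trans (cong (nth t) (tl-cons (encode (N ⊗ N ⊗ N) first) 0)) (nth-zero t))) (similar [] refl [])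
    where
    first : TapeCode
    first = 0 , hd (iterate (cons 1) m 0) , tl (iterate (cons 1) m 0)

  module _ (X : Oracle) where
    open Implementation (machine (program e) X) (system universal X) Simulated

    choose-action : ∀ s a b → choose (toSymbol s) (toAction a) (toAction b) ≡ toAction (ifzero s a b)
    choose-action zero    a b = refl
    choose-action (suc s) a b = refl

    match-instruction : ∀ {q τs l} → τs ≈* l → ∀ tag r →
      machine (program e) X (config q τs) ≡ embed (output (config q τs)) (execute X (withTag tag r) τs) →
      Matches (config q τs) (dispatch X (eval withTagₜ ((tag , r) , e , l)))
    match-instruction rs 0 r eq = _ , ε , trans eq (cong stop (sym (≈value (rs 0))))
    match-instruction {q} {τs} {l} rs 1 r eq = _ , trans eq (cong (λ a → go (perform t a τs))
        (trans (cong (λ s → choose s (toAction a) (toAction b)) (≈scanned (rs t))) (choose-action _ a b)))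
      , _ , ε , simulated (ifzero-same (bit (X 0)))
          (≈put t rs (≈shift d (similar (≈before (rs t)) refl (≈after (rs t)))))
      where
      t = proj₁ (unpair r)
      a = proj₁ (unpair (proj₂ (unpair r)))
      b = proj₂ (unpair (proj₂ (unpair r)))
      d = proj₁ (unpair (proj₂ (unpair (ifzero (proj₁ (proj₂ (tapeAt t l))) a b))))
      ifzero-same : ∀ b {q : ℕ} → q ≡ ifzero b q q
      ifzero-same zero    = refl
      ifzero-same (suc b) = refl
    match-instruction {q} {τs} rs 2 r eq = _ , eq , _ , ε
      , simulated (trans (if-bit (X (value (τs t)))) (cong (λ n → ifzero (bit (X n)) q₀ q₁) (sym (≈value (rs t))))) rs
      where
      t  = proj₁ (unpair r)
      q₀ = proj₁ (unpair (proj₂ (unpair r)))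
      q₁ = proj₂ (unpair (proj₂ (unpair r)))
      if-bit : ∀ b → (if b then q₁ else q₀) ≡ ifzero (bit b) q₀ q₁
      if-bit true  = refl
      if-bit false = refl
    match-instruction {τs = τs} rs (suc (suc (suc tag))) r eq = _ , _ , _ , ε
      , trans eq (cong₂ (λ e m → ask e m (config q↓ τs) (config q↑ τs)) (sym (≈value (rs t))) (sym (≈value (rs t′))))
      , (_ , ε , simulated refl rs) , (_ , ε , simulated refl rs)
      where
      t  = proj₁ (unpair (proj₁ (unpair r)))
      t′ = proj₂ (unpair (proj₁ (unpair r)))
      q↓ = proj₁ (unpair (proj₂ (unpair r)))
      q↑ = proj₂ (unpair (proj₂ (unpair r)))

    opaque
      unfolding universal
      match : ∀ {c s} → Simulated c s → Matches c (system universal X s)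
      match (simulated {q} {τs} {b} {q₁} {q₀} {l} refl rs) =
        match-instruction rs (proj₁ (unpair i)) (proj₂ (unpair i))
          (cong (λ i → embed (output (config q τs)) (execute X i τs)) (fetch-nth e q))
        where
        i : ℕ
        i = nth q e

    module _ {C : Graph} where
      I⇒universal : ∀ {m r} → I X C e m r → Behaviour C (system universal X) (begin (e , m)) r
      I⇒universal {m} i = abstraction match (_ , ε , simulated-begin m) (I⇒behaviour {e = e} i)

      universal⇒I : ∀ {m r} → Behaviour C (system universal X) (begin (e , m)) r → I X C e m r
      universal⇒I {m} b = behaviour⇒I {e = e} (implement match (_ , ε , simulated-begin m) b)

-- The selection program

-- (u , mode , a , w , z), with u the index of the program itself.  Modes 0, 1
-- and 2 belong to compare, 3 and 4 to search, 5 and 6 to probe (see Moves).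
Payload : Ty
Payload = N ⊗ N ⊗ (N ⊗ N) ⊗ (N ⊗ N) ⊗ Simulation

private
  Γ : Ty
  Γ = State Payload

answerₜ selfₜ modeₜ : Tm Γ N
answerₜ = fst
selfₜ   = fst ⊙ snd
modeₜ   = fst ⊙ snd ⊙ snd

goalₜ wordₜ : Tm Γ (N ⊗ N)
goalₜ = fst ⊙ snd ⊙ snd ⊙ snd
wordₜ = fst ⊙ snd ⊙ snd ⊙ snd ⊙ snd

simulationₜ : Tm Γ Simulation
simulationₜ = snd ⊙ snd ⊙ snd ⊙ snd ⊙ snd

three four five six : ∀ {A} → Tm A N
three = suc ⊙ two
four  = suc ⊙ three
five  = suc ⊙ four
six   = suc ⊙ five

origin : ∀ {A} → Tm A (N ⊗ N)
origin = ⟪ zero , zero ⟫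

blankₜ : ∀ {A} → Tm A Simulation
blankₜ = ⟪ zero , ⟪ origin , zero ⟫ ⟫

module _ {A : Ty} where
  payloadₜ : (self mode : Tm A N) → Tm A (N ⊗ N) → Tm A (N ⊗ N) → Tm A Simulation → Tm A Payload
  payloadₜ u mode a w z = ⟪ u , ⟪ mode , ⟪ a , ⟪ w , z ⟫ ⟫ ⟫ ⟫

  callₜ : Tm A Payload → Tm A N
  callₜ z = pack {State Payload} ⊙ ⟪ zero , z ⟫

  haltWithₜ : Tm A N → Tm A (Request Payload)
  haltWithₜ x = ⟪ zero , ⟪ x , ⟪ zero , payloadₜ zero zero origin origin blankₜ ⟫ ⟫ ⟫

  oracleThenₜ : Tm A N → Tm A Payload → Tm A (Request Payload)
  oracleThenₜ x z = ⟪ one , ⟪ x , ⟪ zero , z ⟫ ⟫ ⟫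

  queryThenₜ : Tm A N → Tm A N → Tm A Payload → Tm A (Request Payload)
  queryThenₜ x y z = ⟪ two , ⟪ x , ⟪ y , z ⟫ ⟫ ⟫

-- What comparison does at a request of the simulated program: idle for ever if it halts, pass on an
-- oracle consultation, and replace a query by the swapped comparison. The query is kept as the word
-- of the state, to be asked itself after ↓.
followₜ : Tm (State Payload ⊗ Request Simulation) (Request Payload)
followₜ =
  ifz tagₜ
    (oracleThenₜ zero (stateₜ two (goalₜ ⊙ fst) (simulationₜ ⊙ fst)))
    (ifz (pred′ ⊙ tagₜ)
      (oracleThenₜ (fst ⊙ queryₛ) (stateₜ zero (goalₜ ⊙ fst) zₜ))
      (queryThenₜ (selfₜ ⊙ fst) (callₜ (stateₜ zero queryₛ (beginₜ ⊙ goalₜ ⊙ fst)))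
        (payloadₜ (selfₜ ⊙ fst) one (goalₜ ⊙ fst) queryₛ zₜ)))
  where
  Δ : Ty
  Δ = State Payload ⊗ Request Simulation
  tagₜ : Tm Δ N
  tagₜ = fst ⊙ snd
  queryₛ : Tm Δ (N ⊗ N)
  queryₛ = ⟪ fst ⊙ snd ⊙ snd , fst ⊙ snd ⊙ snd ⊙ snd ⟫
  zₜ : Tm Δ Simulation
  zₜ = snd ⊙ snd ⊙ snd ⊙ snd
  stateₜ : Tm Δ N → Tm Δ (N ⊗ N) → Tm Δ Simulation → Tm Δ Payload
  stateₜ m a z = payloadₜ (selfₜ ⊙ fst) m a origin z

simulateₜ : Tm Γ (Request Payload)
simulateₜ = followₜ ⊙ ⟪ id , universal ⊙ ⟪ answerₜ , simulationₜ ⟫ ⟫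

stateₜ : Tm Γ N → Tm Γ (N ⊗ N) → Tm Γ (N ⊗ N) → Tm Γ Simulation → Tm Γ Payload
stateₜ = payloadₜ selfₜ

resumeₜ idleₜ searchₜ searchedₜ probeₜ probedₜ : Tm Γ (Request Payload)
resumeₜ = ifz answerₜ (haltWithₜ zero)
  (queryThenₜ (fst ⊙ wordₜ) (snd ⊙ wordₜ) (stateₜ zero goalₜ origin simulationₜ))
idleₜ = oracleThenₜ zero (stateₜ two goalₜ wordₜ simulationₜ)
searchₜ = queryThenₜ selfₜ
  (callₜ (stateₜ zero
    ⟪ selfₜ , callₜ (stateₜ five ⟪ fst ⊙ goalₜ , consₜ ⊙ ⟪ fst ⊙ wordₜ , snd ⊙ goalₜ ⟫ ⟫ origin blankₜ) ⟫
    origin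
    (beginₜ ⊙ ⟪ selfₜ , callₜ (stateₜ three goalₜ ⟪ suc ⊙ fst ⊙ wordₜ , zero ⟫ blankₜ) ⟫)))
  (stateₜ four goalₜ wordₜ simulationₜ)
searchedₜ = ifz answerₜ
  (oracleThenₜ zero (stateₜ three goalₜ ⟪ suc ⊙ fst ⊙ wordₜ , zero ⟫ blankₜ))
  (haltWithₜ (fst ⊙ wordₜ))
probeₜ = queryThenₜ (fst ⊙ goalₜ) (snd ⊙ goalₜ) (stateₜ six goalₜ origin blankₜ)
probedₜ = ifz answerₜ
  (queryThenₜ selfₜ (callₜ (stateₜ five goalₜ origin blankₜ)) (stateₜ six goalₜ origin blankₜ))
  (haltWithₜ zero)

selection : Tm (State Payload) (Request Payload)
selection = cases modeₜ (simulateₜ , resumeₜ , idleₜ , searchₜ , searchedₜ , probeₜ , probedₜ)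
  where
  B = Tm Γ (Request Payload)
  cases : Tm Γ N → B × B × B × B × B × B × B → B
  cases m (t₀ , t₁ , t₂ , t₃ , t₄ , t₅ , t₆) =
    ifz m t₀ (ifz (p m) t₁ (ifz (p (p m)) t₂ (ifz (p (p (p m))) t₃
      (ifz (p (p (p (p m)))) t₄ (ifz (p (p (p (p (p m))))) t₅ t₆)))))
    where
    p : Tm Γ N → Tm Γ N
    p m = pred′ ⊙ m

constant : ∀ {A} → ℕ → Tm A N
constant zero    = zero
constant (suc n) = suc ⊙ constant n

eval-constant : ∀ {A} n a → eval (constant {A} n) a ≡ n
eval-constant zero    a = refl
eval-constant (suc n) a = cong suc (eval-constant n a)

entryₜ : ℕ → Tm N (State Payload)
entryₜ u = ⟪ zero , ⟪ constant u , ⟪ three , ⟪ ⟪ hdₜ , tlₜ ⟫ , ⟪ origin , blankₜ ⟫ ⟫ ⟫ ⟫ ⟫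

-- `Self` reads a whole state, its own index included, from its input, so it can call itself in any
-- mode. `Entry u` only differs in its start: it supplies that index as a constant.
module Self = Driver {Payload} unpack selection
module Entry (u : ℕ) = Driver {Payload} (entryₜ u) selection

module Moves (X : Oracle) (u : ℕ) where

  S : Set
  S = ⟦ State Payload ⟧

  blankSim : ⟦ Simulation ⟧
  blankSim = 0 , (0 , 0) , 0

  simulating : ℕ × ℕ → ⟦ State Simulation ⟧ → S
  simulating a (b , z) = b , u , 0 , a , (0 , 0) , z

  resuming : ℕ → ℕ × ℕ → ℕ × ℕ → ⟦ Simulation ⟧ → S
  resuming b a w z = b , u , 1 , a , w , z

  idling : ℕ → ℕ × ℕ → ⟦ Simulation ⟧ → S
  idling b a z = b , u , 2 , a , (0 , 0) , z

  searching searched : ℕ → ℕ → ℕ × ℕ → S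
  searching b k a = b , u , 3 , a , (k , 0) , blankSim
  searched b k a  = b , u , 4 , a , (k , 0) , blankSim

  probing probed : ℕ → ℕ × ℕ → S
  probing b a = b , u , 5 , a , (0 , 0) , blankSim
  probed b a  = b , u , 6 , a , (0 , 0) , blankSim

  opaque
    call : S → ℕ
    call = encode (State Payload)

    parse-call : ∀ s → parse (State Payload) (call s) ≡ s
    parse-call = parse-encode (State Payload)

  compare : ℕ × ℕ → ℕ × ℕ → ℕ
  compare a b = call (simulating a (begin b))

  -- Freezes unless a converges: after the answer ↑ to a, it asks for itself.
  probe : ℕ × ℕ → ℕ
  probe a = call (probing 0 a)

  search : ℕ → ℕ × ℕ → ℕ
  search k a = call (searching 0 k a)

  -- Candidate k against all later ones.
  contest : ℕ → ℕ × ℕ → ℕ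
  contest k a = compare (u , probe (proj₁ a , cons k (proj₂ a))) (u , search (suc k) a)

  opaque
    unfolding call

    -- The simulated system and the simulating one.
    υ : System ⟦ State Simulation ⟧
    υ = system universal X

    σ : System S
    σ = system selection X

    simulate : ℕ × ℕ → ⟦ Simulation ⟧ → ⟦ Request Simulation ⟧ → ⟦ Request Payload ⟧
    simulate a z (0 , x , y , z′)           = 1 , 0 , 0 , (u , 2 , a , (0 , 0) , z)
    simulate a z (1 , x , y , z′)           = 1 , x , 0 , (u , 0 , a , (0 , 0) , z′)
    simulate a z (suc (suc t) , x , y , z′) = 2 , u , compare (x , y) a , (u , 1 , a , (x , y) , z′)

    σ-simulating : ∀ a b z → σ (simulating a (b , z)) ≡ dispatch X (simulate a z (eval universal (b , z)))
    σ-simulating a b z = cong (dispatch X) (by (eval universal (b , z)))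
      where
      by : ∀ q → eval followₜ (simulating a (b , z) , q) ≡ simulate a z q
      by (0 , x , y , z′)           = refl
      by (1 , x , y , z′)           = refl
      by (suc (suc t) , x , y , z′) = refl

    simulating-stop : ∀ {a b z k} → υ (b , z) ≡ stop k → σ (simulating a (b , z)) ≡ go (idling (bit (X 0)) a z)
    simulating-stop {a} {b} {z} eq = trans (σ-simulating a b z) (by (eval universal (b , z)) eq)
      where
      by : ∀ q {k} → dispatch X q ≡ stop k → dispatch X (simulate a z q) ≡ go (idling (bit (X 0)) a z)
      by (0 , x , y , z′) eq = refl
      by (1 , x , y , z′) ()
      by (suc (suc t) , x , y , z′) ()

    simulating-go : ∀ {a b z s} → υ (b , z) ≡ go s → σ (simulating a (b , z)) ≡ go (simulating a s)
    simulating-go {a} {b} {z} eq = trans (σ-simulating a b z) (by (eval universal (b , z)) eq)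
      where
      by : ∀ q {s} → dispatch X q ≡ go s → dispatch X (simulate a z q) ≡ go (simulating a s)
      by (0 , x , y , z′) ()
      by (1 , x , y , z′) refl = refl
      by (suc (suc t) , x , y , z′) ()

    simulating-ask : ∀ {a b z e m s↓ s↑} → υ (b , z) ≡ ask e m s↓ s↑ →
      ∃[ z′ ] s↓ ≡ (1 , z′) × s↑ ≡ (0 , z′) ×
        σ (simulating a (b , z)) ≡ ask u (compare (e , m) a) (resuming 1 a (e , m) z′) (resuming 0 a (e , m) z′)
    simulating-ask {a} {b} {z} eq with by (eval universal (b , z)) eq
      where
      by : ∀ q {e m s↓ s↑} → dispatch X q ≡ ask e m s↓ s↑ → ∃[ z′ ] s↓ ≡ (1 , z′) × s↑ ≡ (0 , z′) ×
        dispatch X (simulate a z q) ≡ ask u (compare (e , m) a) (resuming 1 a (e , m) z′) (resuming 0 a (e , m) z′)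
      by (0 , x , y , z′) ()
      by (1 , x , y , z′) ()
      by (suc (suc t) , x , y , z′) refl = z′ , refl , refl , refl
    ... | z′ , eq↓ , eq↑ , eq′ = z′ , eq↓ , eq↑ , trans (σ-simulating a b z) eq′

    σ-resuming1 : ∀ a e m z → σ (resuming 1 a (e , m) z) ≡ ask e m (simulating a (1 , z)) (simulating a (0 , z))
    σ-resuming1 a e m z = refl

    σ-resuming0 : ∀ a w z → σ (resuming 0 a w z) ≡ stop 0
    σ-resuming0 a w z = refl

    σ-idling : ∀ b a z → σ (idling b a z) ≡ go (idling (bit (X 0)) a z)
    σ-idling b a z = refl

    σ-searching : ∀ b k a → σ (searching b k a) ≡ ask u (contest k a) (searched 1 k a) (searched 0 k a)
    σ-searching b k a = refl

    σ-searched1 : ∀ k a → σ (searched 1 k a) ≡ stop k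
    σ-searched1 k a = refl

    σ-searched0 : ∀ k a → σ (searched 0 k a) ≡ go (searching (bit (X 0)) (suc k) a)
    σ-searched0 k a = refl

    σ-probing : ∀ b a → σ (probing b a) ≡ ask (proj₁ a) (proj₂ a) (probed 1 a) (probed 0 a)
    σ-probing b a = refl

    σ-probed1 : ∀ a → σ (probed 1 a) ≡ stop 0
    σ-probed1 a = refl

    σ-probed0 : ∀ a → σ (probed 0 a) ≡ ask u (probe a) (probed 1 a) (probed 0 a)
    σ-probed0 a = refl

    -- Identities, typed where `σ` and `υ` still unfold; later only the equations above are
    -- available.
    selection⇒σ : ∀ {C s r} → Behaviour C (system selection X) s r → Behaviour C σ s r
    selection⇒σ b = b

    σ⇒selection : ∀ {C s r} → Behaviour C σ s r → Behaviour C (system selection X) s r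
    σ⇒selection b = b

    universal⇒υ : ∀ {C s r} → Behaviour C (system universal X) s r → Behaviour C υ s r
    universal⇒υ b = b

    υ⇒universal : ∀ {C s r} → Behaviour C υ s r → Behaviour C (system universal X) s r
    υ⇒universal b = b

  at-state : program u ≡ Self.driver → ∀ {C s r} → I X C u (call s) r → Behaviour C σ s r
  at-state u-driver {C} {s} i = subst (λ s → Behaviour C σ s _) (parse-call s)
    (selection⇒σ (Self.driver-I⇒behaviour u-driver i))

  from-state : program u ≡ Self.driver → ∀ {C s r} → Behaviour C σ s r → I X C u (call s) r
  from-state u-driver {C} {s} b = Self.driver-behaviour⇒I u-driver
    (σ⇒selection (subst (λ s → Behaviour C σ s _) (sym (parse-call s)) b))

  entry : ∀ e m → eval (entryₜ u) (cons e m) ≡ searching 0 0 (e , m)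
  entry e m = cong₂ (λ u a → 0 , u , 3 , a , (0 , 0) , blankSim) (eval-constant {N} u (cons e m))
    (cong₂ _,_ (hd-cons e m) (tl-cons e m))

  module _ (s : ℕ) (s-driver : program s ≡ Entry.driver u) where

    at-entry : ∀ {C e m r} → I X C s (cons e m) r → Behaviour C σ (searching 0 0 (e , m)) r
    at-entry {C} {e} {m} {r} i =
      subst (λ s → Behaviour C σ s r) (entry e m) (selection⇒σ (Entry.driver-I⇒behaviour u s-driver i))

    from-entry : ∀ {C e m r} → Behaviour C σ (searching 0 0 (e , m)) r → I X C s (cons e m) r
    from-entry {C} {e} {m} {r} b = Entry.driver-behaviour⇒I u s-driver (σ⇒selection
      (subst (λ s → Behaviour C σ s r) (sym (entry e m)) b))

-- Correctness of comparison and search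

module Selection (em : ExcludedMiddle 0ℓ) (X : Oracle) (u : ℕ)
  (at-state : ∀ {C s r} → I X C u (Moves.call X u s) r → Behaviour C (Moves.σ X u) s r)
  (from-state : ∀ {C s r} → Behaviour C (Moves.σ X u) s r → I X C u (Moves.call X u s) r) where

  open Moves X u hiding (at-state; from-state; at-entry; from-entry)

  I⁺ : Graph
  I⁺ = I∞ X

  Dom : ℕ → ℕ → Set
  Dom e m = ∃[ r ] I⁺ e m r

  module _ {C : Graph} where

    private
      Run : ℕ × ℕ → ⟦ State Simulation ⟧ → Set
      Run a s = Behaviour C σ (simulating a s) ↑

      -- In an infinite run no comparison is answered ↑, as that would end it. So every query of the
      -- simulated program is also asked itself, and its answer in C moves the simulation on.
      run-progress : ∀ {a s} → Run a s → (∃[ k ] υ s ≡ stop k) ⊎ (∃[ s′ ] Trans C υ s s′ × Run a s′)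
      run-progress {a} {s} beh with υ s in eq
      ... | stop k = inj₁ (k , refl)
      ... | go s′  = inj₂ (s′ , silent eq , behaviour-go {r = ↑} (simulating-go eq) beh)
      ... | ask e m s↓ s↑ with simulating-ask {a} eq
      ... | z′ , refl , refl , eq′ with behaviour-ask {r = ↑} eq′ beh
      ... | inj₂ (_ , beh′) with () ← behaviour-stop {r = ↑} (σ-resuming0 a (e , m) z′) beh′
      run-progress {a} beh | ask e m s↓ s↑ | z′ , refl , refl , eq′ | inj₁ (_ , _ , beh′) =
        resumed (behaviour-ask {r = ↑} (σ-resuming1 a e m z′) beh′)
        where
        resumed : (∃[ k ] C e m (↓ k) × Run a (1 , z′)) ⊎ (C e m ↑ × Run a (0 , z′)) →
                  (∃[ k ] ask e m (1 , z′) (0 , z′) ≡ stop k) ⊎ (∃[ s′ ] Trans C υ _ s′ × Run a s′)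
        resumed (inj₁ (_ , c , beh″)) = inj₂ (_ , answered↓ eq c , beh″)
        resumed (inj₂ (c , beh″))     = inj₂ (_ , answered↑ eq c , beh″)

    -- That the same C answers the queries of b matters: the derivation of b is then part of that of
    -- the comparison, on which inductions can rely.
    compare↑ : ∀ {a b} → I X C u (compare a b) ↑ → ∃[ r ] I X C (proj₁ b) (proj₂ b) r
    compare↑ {a} {b} i =
      let r , beh = progress⇒behaviour {σ = υ} em {Run a} run-progress {begin b} (at-state {C} {simulating a (begin b)} {↑} i)
      in r , universal⇒I (proj₁ b) X {C} {proj₂ b} {r} (υ⇒universal {r = r} beh)

    -- The only way to stop is the answer ↑ to a swapped comparison, since reaching the end of b
    -- leads to idling.
    compare↓ : ∀ {a b k} → I X C u (compare a b) (↓ k) → ∃[ b′ ] C u (compare b′ a) ↑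
    compare↓ {a} {b} {k} i with at-state {C} {simulating a (begin b)} {↓ k} i
    ... | _ , p , stopped = settle p stopped (sim (begin b))
      where
      data Phase : S → Set where
        sim  : ∀ s → Phase (simulating a s)
        res  : ∀ w z → Phase (resuming 1 a w z)
        idle : ∀ b z → Phase (idling b a z)
      settle : ∀ {s h k} → Star (Trans C σ) s h → σ h ≡ stop k → Phase s → ∃[ b′ ] C u (compare b′ a) ↑
      settle p eq (sim s) with υ s in eqᵤ
      settle ε eq (sim s) | stop _ with () ← trans (sym eq) (simulating-stop {a} eqᵤ)
      settle (t ◅ p) eq (sim s) | stop _ with refl ← trans-go (simulating-stop eqᵤ) t = settle p eq (idle _ _)
      settle ε eq (sim s) | go _ with () ← trans (sym eq) (simulating-go {a} eqᵤ)
      settle (t ◅ p) eq (sim s) | go s′ with refl ← trans-go (simulating-go eqᵤ) t = settle p eq (sim s′)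
      settle p eq (sim s) | ask e m _ _ with simulating-ask {a} eqᵤ
      settle ε eq (sim s) | ask e m _ _ | z′ , _ , _ , eq′ with () ← trans (sym eq) eq′
      settle (t ◅ p) eq (sim s) | ask e m _ _ | z′ , _ , _ , eq′ with trans-ask eq′ t
      ... | inj₁ (_ , _ , refl) = settle p eq (res _ _)
      ... | inj₂ (c , _)        = (e , m) , c
      settle ε eq (res (e , m) z) with () ← trans (sym eq) (σ-resuming1 a e m z)
      settle (t ◅ p) eq (res (e , m) z) with trans-ask (σ-resuming1 a e m z) t
      ... | inj₁ (_ , _ , refl) = settle p eq (sim _)
      ... | inj₂ (_ , refl)     = settle p eq (sim _)
      settle ε eq (idle b z) with () ← trans (sym eq) (σ-idling b a z)
      settle (t ◅ p) eq (idle b z) with refl ← trans-go (σ-idling b a z) t = settle p eq (idle _ _)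

  unfold : ∀ {e m r} → I⁺ e m r → I X I⁺ e m r
  unfold (closed i) = i

  winner : ∀ {a b k} → I⁺ u (compare a b) (↓ k) → Dom (proj₁ a) (proj₂ a)
  winner {a} {b} x with compare↓ {a = a} {b} (unfold x)
  ... | b′ , y = map₂ closed (compare↑ {a = b′} {a} (unfold y))

  module _ (a : ℕ × ℕ) (Good : ⟦ State Simulation ⟧ → Set)
    (good-go : ∀ {s s′} → Good s → υ s ≡ go s′ → Good s′)
    (good-ask : ∀ {s e m s↓ s↑} → Good s → υ s ≡ ask e m s↓ s↑ →
      Dom u (compare (e , m) a) ×
      (Dom e m → (∃[ k ] I⁺ e m (↓ k) × Good s↓) ⊎ (I⁺ e m ↑ × Good s↑))) where

    -- `Good` is what is known of the simulated program. At a query it must make the swapped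
    -- comparison defined, but an answer to the query itself only if the query is defined.
    compare-defined : ∀ {b} → Good (begin b) → Dom u (compare a b)
    compare-defined {b} good = map₂ (λ {r} beh → closed (from-state {I⁺} {simulating a (begin b)} {r} beh))
      (progress⇒behaviour em {Inv} progress (sim good))
      where
      data Inv : S → Set where
        sim  : ∀ {s} → Good s → Inv (simulating a s)
        res1 : ∀ {e m z} → (∃[ k ] I⁺ e m (↓ k) × Good (1 , z)) ⊎ (I⁺ e m ↑ × Good (0 , z)) → Inv (resuming 1 a (e , m) z)
        res0 : ∀ {w z} → Inv (resuming 0 a w z)
        idle : ∀ {b z} → Inv (idling b a z)
      progress : ∀ {s} → Inv s → (∃[ k ] σ s ≡ stop k) ⊎ (∃[ s′ ] Trans I⁺ σ s s′ × Inv s′)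
      progress (sim {s} g) with υ s in eq
      ... | stop k = inj₂ (_ , silent (simulating-stop eq) , idle)
      ... | go s′ = inj₂ (_ , silent (simulating-go eq) , sim (good-go g eq))
      ... | ask e m _ _ with simulating-ask {a} eq | good-ask g eq
      ... | z′ , refl , refl , eq′ | (↓ k , x) , next =
        -- The answer ↓ guarantees, by `winner`, that the query about to be asked does not freeze.
        inj₂ (_ , answered↓ eq′ x , res1 (next (winner {e , m} {a} x)))
      ... | z′ , refl , refl , eq′ | (↑ , x) , next = inj₂ (_ , answered↑ eq′ x , res0)
      progress (res1 {e} {m} {z} (inj₁ (k , x , g))) = inj₂ (_ , answered↓ (σ-resuming1 a e m z) x , sim g)
      progress (res1 {e} {m} {z} (inj₂ (x , g))) = inj₂ (_ , answered↑ (σ-resuming1 a e m z) x , sim g)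
      progress (res0 {w} {z}) = inj₁ (0 , σ-resuming0 a w z)
      progress (idle {b} {z}) = inj₂ (_ , silent (σ-idling b a z) , idle)

  -- The simulated program is a, which may freeze. Still the comparison does not: it asks a query b′
  -- of a only after `compare b′ b` has converged, which shows b′ to be defined.
  compare-definedˡ : ∀ {b} → (∀ b′ → Dom u (compare b′ b)) → ∀ a → Dom u (compare b a)
  compare-definedˡ {b} all a = compare-defined b (λ _ → ⊤) (λ _ _ → tt)
      (λ {s} {e} {m} _ _ → all (e , m) , λ { (↓ k , x) → inj₁ (k , x , tt) ; (↑ , x) → inj₂ (x , tt) }) {a} tt

  module _ {E : Graph} (E-defined : ∀ {e m r} → E e m r → ∀ a → Dom u (compare (e , m) a)) where

    private
      C : Graph
      C e m r = I⁺ e m r × E e m r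

    -- The simulated program has a behaviour over C, so each query it reaches is answered there and
    -- comes with E, which makes the swapped comparison defined.
    compare-definedʳ : ∀ {e m r} → I X C e m r → ∀ a → Dom u (compare a (e , m))
    compare-definedʳ {e} {m} {r} i a = compare-defined a Good good-go good-ask {e , m} (r , universal⇒υ {r = r} (I⇒universal e X i))
      where
      Good : ⟦ State Simulation ⟧ → Set
      Good s = ∃[ r ] Behaviour C υ s r
      good-go : ∀ {s s′} → Good s → υ s ≡ go s′ → Good s′
      good-go (r , b) eq = r , behaviour-go {r = r} eq b
      good-ask : ∀ {s e m s↓ s↑} → Good s → υ s ≡ ask e m s↓ s↑ → Dom u (compare (e , m) a) ×
        (Dom e m → (∃[ k ] I⁺ e m (↓ k) × Good s↓) ⊎ (I⁺ e m ↑ × Good s↑))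
      good-ask (r , b) eq with behaviour-ask {r = r} eq b
      ... | inj₁ (k , (x , d) , b′) = E-defined d a , λ _ → inj₁ (k , x , r , b′)
      ... | inj₂ ((x , d) , b′)     = E-defined d a , λ _ → inj₂ (x , r , b′)

  private
    Favoured : Graph
    Favoured e m r = (∀ a → Dom u (compare a (e , m))) × (∀ a → Dom u (compare (e , m) a))

    -- Simultaneous induction: being defined on the right follows from being defined on the left at
    -- the queries, and then on the left from the right at the same computation.
    favoured : ∀ {e m r} → I⁺ e m r → Favoured e m r
    favoured = I∞-induction Favoured λ {e} {m} {r} i →
      let right = compare-definedʳ {Favoured} proj₂ i in right , compare-definedˡ right

  compareʳ : ∀ {b} → Dom (proj₁ b) (proj₂ b) → ∀ a → Dom u (compare a b)
  compareʳ (_ , x) = proj₁ (favoured x)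

  compareˡ : ∀ {b} → Dom (proj₁ b) (proj₂ b) → ∀ a → Dom u (compare b a)
  compareˡ (_ , x) = proj₂ (favoured x)

  Converges : ℕ × ℕ → Set
  Converges a = ∃[ k ] I⁺ (proj₁ a) (proj₂ a) (↓ k)

  probe-defined : ∀ {a} → Converges a → Dom u (probe a)
  probe-defined {a} (k , x) = ↓ 0 , closed (from-state {I⁺} {probing 0 a} {↓ 0}
    (_ , answered↓ (σ-probing 0 a) x ◅ ε , σ-probed1 a))

  -- If the answer to a is ↑, the probe asks for itself, and its derivation contains another one of
  -- the same probe, to which the induction hypothesis applies.
  probe-converges : ∀ {a} → Dom u (probe a) → Converges a
  probe-converges {a} (r , x) = I∞-induction Probe step x a refl refl
    where
    Probe : Graph
    Probe e m r = ∀ a → e ≡ u → m ≡ probe a → Converges a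
    C : Graph
    C e m r = I⁺ e m r × Probe e m r
    step : ∀ {e m r} → I X C e m r → Probe e m r
    step {r = r} i a refl refl with behaviour-ask {r = r} (σ-probing 0 a) (at-state {C} {probing 0 a} {r} i)
    ... | inj₁ (k , (x , _) , _) = k , x
    ... | inj₂ (_ , b) with behaviour-ask {r = r} (σ-probed0 a) b
    ... | inj₁ (_ , (_ , p) , _) = p a refl refl
    ... | inj₂ ((_ , p) , _)     = p a refl refl

  module _ (a : ℕ × ℕ) where

    candidate : ℕ → ℕ × ℕ
    candidate k = proj₁ a , cons k (proj₂ a)

    Selected : ℕ → Set
    Selected k = ∃[ q ] I⁺ u (search k a) (↓ q) × Converges (candidate q)

    module _ {C : Graph} where

      search-cases : ∀ {k r} → I X C u (search k a) r → (∃[ j ] C u (contest k a) (↓ j)) ⊎ C u (contest k a) ↑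
      search-cases {k} {r} i with behaviour-ask {r = r} (σ-searching 0 k a) (at-state {C} {searching 0 k a} {r} i)
      ... | inj₁ (j , c , _) = inj₁ (j , c)
      ... | inj₂ (c , _)     = inj₂ c

    search-here : ∀ {k j} → I⁺ u (contest k a) (↓ j) → I⁺ u (search k a) (↓ k)
    search-here {k} c = closed (from-state {I⁺} {searching 0 k a} {↓ k}
      (_ , answered↓ (σ-searching 0 k a) c ◅ ε , σ-searched1 k a))

    search-later : ∀ {k r} → I⁺ u (contest k a) ↑ → I⁺ u (search (suc k) a) r → I⁺ u (search k a) r
    search-later {k} {r} c x = closed (from-state {I⁺} {searching 0 k a} {r}
      (cons-behaviour {r = r} (answered↑ (σ-searching 0 k a) c)
        (cons-behaviour {r = r} (silent (σ-searched0 k a)) (restart (at-state {I⁺} {searching 0 (suc k) a} {r} (unfold x))))))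
      where
      -- After losing, the search goes on with X(0) in the place of the last answer, while a fresh
      -- one has 0 there; the first move ignores it.
      restart : Behaviour I⁺ σ (searching 0 (suc k) a) r → Behaviour I⁺ σ (searching (bit (X 0)) (suc k) a) r
      restart beh with behaviour-ask {r = r} (σ-searching 0 (suc k) a) beh
      ... | inj₁ (_ , c , beh′) = cons-behaviour {r = r} (answered↓ (σ-searching (bit (X 0)) (suc k) a) c) beh′
      ... | inj₂ (c , beh′)     = cons-behaviour {r = r} (answered↑ (σ-searching (bit (X 0)) (suc k) a) c) beh′

    -- One step of the search over any C inside `I⁺`, so that it serves both within the induction on
    -- derivations and after it.
    select : ∀ {C : Graph} → (∀ {e m r} → C e m r → I⁺ e m r) →
      (∀ {k} → C u (contest k a) ↑ → Selected (suc k)) → ∀ {k r} → I X C u (search k a) r → Selected k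
    select sub later {k} i with search-cases i
    ... | inj₁ (j , c) = k , search-here (sub c) ,
      probe-converges (winner {u , probe (candidate k)} {u , search (suc k) a} (sub c))
    ... | inj₂ c with later c
    ... | q , x , y = q , search-later (sub c) x , y

    -- The derivation of contest k ↑ contains the answers to the queries of
    -- search (suc k), so a search cannot be postponed forever.
    contest↑ : ∀ {k} → I⁺ u (contest k a) ↑ → Selected (suc k)
    contest↑ {k} x = I∞-induction Postponed step x k refl refl refl
      where
      Postponed : Graph
      Postponed e m r = ∀ k → e ≡ u → m ≡ contest k a → r ≡ ↑ → Selected (suc k)
      step : ∀ {e m r} → I X (λ e m r → I⁺ e m r × Postponed e m r) e m r → Postponed e m r
      step i k refl refl refl = select proj₁ (λ { {k} (_ , p) → p k refl refl refl })
        (proj₂ (compare↑ {a = u , probe (candidate k)} {u , search (suc k) a} i))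

    search-selects : ∀ {k} → Dom u (search k a) → Selected k
    search-selects (_ , x) = select (λ x → x) contest↑ (unfold x)

    -- After ↑ the search continues as `search (suc k)`, which the comparison has just shown to be
    -- defined.
    contest-defined⇒search-defined : ∀ {k} → Dom u (contest k a) → Dom u (search k a)
    contest-defined⇒search-defined (↓ j , c) = _ , search-here c
    contest-defined⇒search-defined (↑ , c) with contest↑ c
    ... | q , x , _ = _ , search-later c x

    -- At p the contest is defined through its left side, although the later search may freeze.
    -- Below p it is defined through its right side, although the probe may freeze.
    search-defined : ∀ {p} → Converges (candidate p) → Dom u (search 0 a)
    search-defined {p} conv = backwards p (contest-defined⇒search-defined
      (compareˡ {u , probe (candidate p)} (probe-defined conv) (u , search (suc p) a)))
      where
      backwards : ∀ k → Dom u (search k a) → Dom u (search 0 a)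
      backwards zero    d = d
      backwards (suc k) d = backwards k (contest-defined⇒search-defined
        (compareʳ {u , search (suc k) a} d (u , probe (candidate k))))

  module _ (s : ℕ)
    (at-entry : ∀ {C e m r} → I X C s (cons e m) r → Behaviour C σ (searching 0 0 (e , m)) r)
    (from-entry : ∀ {C e m r} → Behaviour C σ (searching 0 0 (e , m)) r → I X C s (cons e m) r) where

    Sel : (ℕ × List ℕ) ⇀ ℕ
    Sel = record
      { graph      = λ (n , m⃗) k → I⁺ s (code (n ∷ m⃗)) (↓ k)
      ; functional = λ x y → ↓-injective (I∞-functional x y)
      }
      where
      ↓-injective : ∀ {k k′} → ↓ k ≡ ↓ k′ → k ≡ k′
      ↓-injective refl = refl

    Sel-computed : s Computes Sel In X
    Sel-computed n m⃗ k = mk⇔ (λ x → x) (λ x → x)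

    Sel-selects : Selects X Sel
    Sel-selects e m⃗ = mk⇔
      (λ (p , conv) → let q , x , y = search-selects a (search-defined a {p} conv) in
        q , closed (from-entry {r = ↓ q} (at-state {I⁺} {searching 0 0 a} {↓ q} (unfold x))) , y)
      (λ (q , _ , conv) → q , conv)
      where
      a : ℕ × ℕ
      a = e , code m⃗

theorem2p30 : ExcludedMiddle 0ℓ →
    (∀ (X : Oracle) → Σ[ Sel ∈ ((ℕ × List ℕ) ⇀ ℕ) ] (PartialFeedbackComputableIn X Sel × Selects X Sel))
    ×
    (∃[ s ] (∀ (X : Oracle) → Σ[ Sel ∈ ((ℕ × List ℕ) ⇀ ℕ) ] ((s Computes Sel In X) × Selects X Sel)))
theorem2p30 em = conclude (indexed Self.driver)
  where
  Uniform : ℕ → Set₁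
  Uniform s = ∀ X → Σ[ Sel ∈ ((ℕ × List ℕ) ⇀ ℕ) ] ((s Computes Sel In X) × Selects X Sel)

  indexed : ∀ P → ∃[ e ] program e ≡ P
  indexed P = index P , program-index P

  -- The indices are kept variable here: their numerals are far too large to
  -- be evaluated.
  uniform : ∀ u s → program u ≡ Self.driver → program s ≡ Entry.driver u → Uniform s
  uniform u s u-driver s-driver X =
    M.Sel s at-s from-s , M.Sel-computed s at-s from-s , M.Sel-selects s at-s from-s
    where
    module M = Selection em X u (Moves.at-state X u u-driver) (Moves.from-state X u u-driver)
    at-s = Moves.at-entry X u s s-driver
    from-s = Moves.from-entry X u s s-driver

  finish : ∀ {s} → Uniform s →
    (∀ X → Σ[ Sel ∈ ((ℕ × List ℕ) ⇀ ℕ) ] (PartialFeedbackComputableIn X Sel × Selects X Sel)) × (∃[ s ] Uniform s)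
  finish {s} f = (λ X → proj₁ (f X) , (s , proj₁ (proj₂ (f X))) , proj₂ (proj₂ (f X))) , s , f

  conclude : (∃[ u ] program u ≡ Self.driver) →
    (∀ X → Σ[ Sel ∈ ((ℕ × List ℕ) ⇀ ℕ) ] (PartialFeedbackComputableIn X Sel × Selects X Sel)) × (∃[ s ] Uniform s)
  conclude (u , u-driver) = enter (indexed (Entry.driver u))
    where
    enter : (∃[ s ] program s ≡ Entry.driver u) → _
    enter (s , s-driver) = finish (uniform u s u-driver s-driver)
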